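{- Let $\mathcal{C}$ be a locally cartesian closed category equipped with a model structure such that: (i) the cofibrations are exactly the monomorphisms; (ii) the pushout-product of a cofibration with a trivial cofibration is a trivial cofibration; (iii) $I$ is a good (not necessarily very good) cylinder object for the terminal object $1$, with two disjoint endpoint inclusions $\{0\},\{1\}\colon 1\rightrightarrows I$; (iv) the model structure is right proper. Let $i\colon \partial B\hookrightarrow B$ be a cofibration, let $\underline{E}\to B$ be a fibration and $\partial\underline{E}:=i^*\underline{E}\to\partial B$ its pullback, let $\partial E\to\partial B$ be a fibration and let $\partial w\colon \partial E\to\partial\underline{E}$ be a map over $\partial B$. Suppose $\partial w$ has a homotopy retraction $\partial r\colon\partial\underline{E}\to\partial E$ over $\partial B$ together with a homotopy $\partial H_r\colon \partial E\to P^I_{\partial B}(\partial E)$ over $\partial B$ with $\mathrm{ev}_0\circ\partial H_r=\partial r\circ\partial w$ and $\mathrm{ev}_1\circ\partial H_r=\mathrm{id}_{\partial E}$, and a homotopy section $\partial s\colon\partial\underline{E}\to\partial E$ over $\partial B$ together with a homotopy $\partial H_s\colon\partial\underline{E}\to P^I_{\partial B}(\partial\underline{E})$ over $\partial B$ with $\mathrm{ev}_0\circ\partial H_s=\partial w\circ\partial s$ and $\mathrm{ev}_1\circ\partial H_s=\mathrm{id}_{\partial\underline{E}}$. Let $E:=\mathsf{Glue}_{i,\underline{E}}(\partial w)$ and $w:=\mathsf{unglue}_{i,\underline{E}}(\partial w)\colon E\to\underline{E}$ (so that $i^*E\cong\partial E$ and $i^*w=\partial w$). Then: (1) there exist a map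 $r\colon\underline{E}\to E$ over $B$ and a homotopy $H_r\colon E\to P^I_B(E)$ over $B$ with $\mathrm{ev}_0\circ H_r=r\circ w$ and $\mathrm{ev}_1\circ H_r=\mathrm{id}_E$, such that the pullbacks of $r$ and $H_r$ along $i$ are $\partial r$ and $\partial H_r$; (2) there exist a map $s\colon\underline{E}\to E$ over $B$ and a homotopy $H_s\colon\underline{E}\to P^I_B(\underline{E})$ over $B$ with $\mathrm{ev}_0\circ H_s=w\circ s$ and $\mathrm{ev}_1\circ H_s=\mathrm{id}_{\underline{E}}$, such that the pullbacks of $s$ and $H_s$ along $i$ are $\partial s$ and $\partial H_s$.
   Context: "Good cylinder object for $1$" means the induced map $1\sqcup 1\to I$ is a cofibration and $I\to 1$ is a weak equivalence; the endpoints are disjoint when the pullback of $\{0\}$ and $\{1\}$ is initial. For a map $Y\to C$, the fibred path object $P^I_C(Y):=[C\times I,Y]_C$ is the local exponential in $\mathcal{C}/C$, with evaluation maps $\mathrm{ev}_0,\mathrm{ev}_1\colon P^I_C(Y)\to Y$ induced by $\{0\},\{1\}$; it is stable under pullback, so $i^*P^I_B(X)\cong P^I_{\partial B}(i^*X)$. Glue construction: for a mono $i\colon\partial B\hookrightarrow B$, an object $\underline{E}\to B$ with $\partial\underline{E}=i^*\underline{E}$, and a map $f\colon\partial E\to\partial\underline{E}$, let $i_*$ be the pushforward (right adjoint of pullback $i^*$) and $\eta\colon\underline{E}\to i_*i^*\underline{E}=i_*\partial\underline{E}$ the unit. Then $\mathsf{Glue}_{i,\underline{E}}(f)$ is the pullback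 of $i_*f\colon i_*\partial E\to i_*\partial\underline{E}$ along $\eta$, and $\mathsf{unglue}_{i,\underline{E}}(f)\colon\mathsf{Glue}_{i,\underline{E}}(f)\to\underline{E}$ is the projection. -}

module Defs where

open import Level using (Level; _⊔_) renaming (suc to lsuc)
open import Data.Product using (Σ; Σ-syntax; _×_; _,_)
open import Relation.Binary.PropositionalEquality
  using (_≡_; refl; sym; trans; cong; module ≡-Reasoning)

record Category (o h : Level) : Set (lsuc (o ⊔ h)) where
  infixr 9 _∘_
  field
    Obj : Set o
    Hom : Obj → Obj → Set h
    id  : ∀ {A} → Hom A A
    _∘_ : ∀ {A B C} → Hom B C → Hom A B → Hom A C
    identityˡ : ∀ {A B} {f : Hom A B} → id ∘ f ≡ f
    identityʳ : ∀ {A B} {f : Hom A B} → f ∘ id ≡ f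
    assoc : ∀ {A B C D} {f : Hom A B} {g : Hom B C} {k : Hom C D} →
            (k ∘ g) ∘ f ≡ k ∘ (g ∘ f)

module Basic {o h} (𝒞 : Category o h) where
  open Category 𝒞

  Mono : ∀ {A B} → Hom A B → Set (o ⊔ h)
  Mono {A} f = ∀ {Z} (g k : Hom Z A) → f ∘ g ≡ f ∘ k → g ≡ k

  record IsTerminal (T : Obj) : Set (o ⊔ h) where
    field
      ! : ∀ {A} → Hom A T
      !-unique : ∀ {A} (f : Hom A T) → f ≡ !

  record IsInitial (Z : Obj) : Set (o ⊔ h) where
    field
      ¡ : ∀ {A} → Hom Z A
      ¡-unique : ∀ {A} (f : Hom Z A) → f ≡ ¡

  record Pullback {A B C} (f : Hom A C) (g : Hom B C) : Set (o ⊔ h) where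
    field
      P  : Obj
      p₁ : Hom P A
      p₂ : Hom P B
      commute : f ∘ p₁ ≡ g ∘ p₂
      pair : ∀ {Z} (a : Hom Z A) (b : Hom Z B) → f ∘ a ≡ g ∘ b → Hom Z P
      p₁∘pair : ∀ {Z} {a : Hom Z A} {b : Hom Z B} (e : f ∘ a ≡ g ∘ b) →
                p₁ ∘ pair a b e ≡ a
      p₂∘pair : ∀ {Z} {a : Hom Z A} {b : Hom Z B} (e : f ∘ a ≡ g ∘ b) →
                p₂ ∘ pair a b e ≡ b
      pair-unique : ∀ {Z} {a : Hom Z A} {b : Hom Z B} (e : f ∘ a ≡ g ∘ b)
                    (u : Hom Z P) → p₁ ∘ u ≡ a → p₂ ∘ u ≡ b → u ≡ pair a b e

  record Pushout {A B C} (f : Hom A B) (g : Hom A C) : Set (o ⊔ h) where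
    field
      Q  : Obj
      ι₁ : Hom B Q
      ι₂ : Hom C Q
      commute : ι₁ ∘ f ≡ ι₂ ∘ g
      copair : ∀ {Z} (u : Hom B Z) (v : Hom C Z) → u ∘ f ≡ v ∘ g → Hom Q Z
      copair∘ι₁ : ∀ {Z} {u : Hom B Z} {v : Hom C Z} (e : u ∘ f ≡ v ∘ g) →
                  copair u v e ∘ ι₁ ≡ u
      copair∘ι₂ : ∀ {Z} {u : Hom B Z} {v : Hom C Z} (e : u ∘ f ≡ v ∘ g) →
                  copair u v e ∘ ι₂ ≡ v
      copair-unique : ∀ {Z} {u : Hom B Z} {v : Hom C Z} (e : u ∘ f ≡ v ∘ g)
                      (t : Hom Q Z) → t ∘ ι₁ ≡ u → t ∘ ι₂ ≡ v → t ≡ copair u v e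

  HasPullbacks : Set (o ⊔ h)
  HasPullbacks = ∀ {A B C} (f : Hom A C) (g : Hom B C) → Pullback f g

  module Reindex (pb : HasPullbacks) where
    open Pullback

    reindex : ∀ {A C Y Y'} (f : Hom A C) {g : Hom Y C} {g' : Hom Y' C}
              (y : Hom Y Y') → g' ∘ y ≡ g → Hom (P (pb f g)) (P (pb f g'))
    reindex f {g} {g'} y e =
      pair (pb f g') (p₁ (pb f g)) (y ∘ p₂ (pb f g))
        (trans (commute (pb f g))
          (trans (cong (_∘ p₂ (pb f g)) (sym e)) assoc))

    -- Right adjoint Π_f of f^* : 𝒞/B → 𝒞/A, evaluated at (Y , g),
    -- given by its universal arrow (counit ε).
    record Pushforward {A B Y} (f : Hom A B) (g : Hom Y A) : Set (o ⊔ h) where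
      field
        Π : Obj
        π : Hom Π B
        ε : Hom (P (pb f π)) Y
        ε-over : g ∘ ε ≡ p₁ (pb f π)
        transpose : ∀ {Z} (z : Hom Z B) (u : Hom (P (pb f z)) Y) →
                    g ∘ u ≡ p₁ (pb f z) → Hom Z Π
        transpose-over : ∀ {Z} {z : Hom Z B} {u : Hom (P (pb f z)) Y}
                         (e : g ∘ u ≡ p₁ (pb f z)) → π ∘ transpose z u e ≡ z
        transpose-ε : ∀ {Z} {z : Hom Z B} {u : Hom (P (pb f z)) Y}
                      (e : g ∘ u ≡ p₁ (pb f z)) →
                      ε ∘ reindex f (transpose z u e) (transpose-over e) ≡ u
        transpose-unique : ∀ {Z} {z : Hom Z B} {u : Hom (P (pb f z)) Y}
                           (e : g ∘ u ≡ p₁ (pb f z)) (t : Hom Z Π)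
                           (t-over : π ∘ t ≡ z) →
                           ε ∘ reindex f t t-over ≡ u → t ≡ transpose z u e

  record LCCC : Set (o ⊔ h) where
    field
      ⊤ : Obj
      ⊤-terminal : IsTerminal ⊤
      pullback : HasPullbacks
      pushforward : ∀ {A B Y} (f : Hom A B) (g : Hom Y A) →
                    Reindex.Pushforward pullback f g

  record FinColimits : Set (o ⊔ h) where
    field
      ⊥ : Obj
      ⊥-initial : IsInitial ⊥
      pushout : ∀ {A B C} (f : Hom A B) (g : Hom A C) → Pushout f g

  record IsRetractOf {A B X Y} (f : Hom A B) (g : Hom X Y) : Set h where
    field
      s₀ : Hom A X
      r₀ : Hom X A
      s₁ : Hom B Y
      r₁ : Hom Y B
      r₀∘s₀ : r₀ ∘ s₀ ≡ id
      r₁∘s₁ : r₁ ∘ s₁ ≡ id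
      sq-s : g ∘ s₀ ≡ s₁ ∘ f
      sq-r : f ∘ r₀ ≡ r₁ ∘ g

  HasLift : ∀ {A B X Y} (f : Hom A B) (g : Hom X Y) → Set h
  HasLift {A} {B} {X} {Y} f g =
    (u : Hom A X) (v : Hom B Y) → g ∘ u ≡ v ∘ f →
    Σ[ d ∈ Hom B X ] ((d ∘ f ≡ u) × (g ∘ d ≡ v))

  record ModelStructure (ℓ : Level) : Set (o ⊔ h ⊔ lsuc ℓ) where
    field
      Cof Fib W : ∀ {A B} → Hom A B → Set ℓ
      W-∘ : ∀ {A B C} {f : Hom A B} {g : Hom B C} → W f → W g → W (g ∘ f)
      W-cancelˡ : ∀ {A B C} {f : Hom A B} {g : Hom B C} → W (g ∘ f) → W g → W f
      W-cancelʳ : ∀ {A B C} {f : Hom A B} {g : Hom B C} → W (g ∘ f) → W f → W g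
      Cof-retract : ∀ {A B X Y} {f : Hom A B} {g : Hom X Y} → IsRetractOf f g → Cof g → Cof f
      Fib-retract : ∀ {A B X Y} {f : Hom A B} {g : Hom X Y} → IsRetractOf f g → Fib g → Fib f
      W-retract : ∀ {A B X Y} {f : Hom A B} {g : Hom X Y} → IsRetractOf f g → W g → W f
      lift-Cof-TFib : ∀ {A B X Y} {f : Hom A B} {g : Hom X Y} →
                      Cof f → Fib g → W g → HasLift f g
      lift-TCof-Fib : ∀ {A B X Y} {f : Hom A B} {g : Hom X Y} →
                      Cof f → W f → Fib g → HasLift f g
      factor-TCof-Fib : ∀ {A B} (f : Hom A B) →
        Σ[ M ∈ Obj ] Σ[ c ∈ Hom A M ] Σ[ p ∈ Hom M B ]
          ((p ∘ c ≡ f) × Cof c × W c × Fib p)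
      factor-Cof-TFib : ∀ {A B} (f : Hom A B) →
        Σ[ M ∈ Obj ] Σ[ c ∈ Hom A M ] Σ[ p ∈ Hom M B ]
          ((p ∘ c ≡ f) × Cof c × Fib p × W p)

  module Products (L : LCCC) where
    open LCCC L
    open IsTerminal ⊤-terminal
    open Pullback

    infixr 7 _×ₒ_
    _×ₒ_ : Obj → Obj → Obj
    A ×ₒ B = P (pullback (! {A}) (! {B}))

    π₁ : ∀ {A B} → Hom (A ×ₒ B) A
    π₁ {A} {B} = p₁ (pullback (! {A}) (! {B}))

    π₂ : ∀ {A B} → Hom (A ×ₒ B) B
    π₂ {A} {B} = p₂ (pullback (! {A}) (! {B}))

    ⟨_,_⟩ : ∀ {Z A B} → Hom Z A → Hom Z B → Hom Z (A ×ₒ B)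
    ⟨_,_⟩ {Z} {A} {B} a b =
      pair (pullback (! {A}) (! {B})) a b (trans (!-unique _) (sym (!-unique _)))

    π₁∘⟨⟩ : ∀ {Z A B} {a : Hom Z A} {b : Hom Z B} → π₁ ∘ ⟨ a , b ⟩ ≡ a
    π₁∘⟨⟩ {Z} {A} {B} = p₁∘pair (pullback (! {A}) (! {B})) _

    infixr 8 _⊗_
    _⊗_ : ∀ {A B C D} → Hom A B → Hom C D → Hom (A ×ₒ C) (B ×ₒ D)
    f ⊗ g = ⟨ f ∘ π₁ , g ∘ π₂ ⟩

    π₁∘⊗ : ∀ {A B C D} {f : Hom A B} {g : Hom C D} → π₁ ∘ (f ⊗ g) ≡ f ∘ π₁
    π₁∘⊗ = π₁∘⟨⟩

  module Hyps (L : LCCC) (K : FinColimits) {ℓ} (M : ModelStructure ℓ) where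
    open LCCC L
    open FinColimits K
    open ModelStructure M
    open IsTerminal ⊤-terminal
    open IsInitial ⊥-initial
    open Products L

    CofibrationsAreMonos : Set (o ⊔ h ⊔ ℓ)
    CofibrationsAreMonos = ∀ {A B} (f : Hom A B) → (Cof f → Mono f) × (Mono f → Cof f)

    -- (ii) pushout-product of a cofibration f with a trivial cofibration g
    -- is a trivial cofibration.  f □ g is the map out of the pushout of
    --   B × X <--f⊗X-- A × X --A⊗g--> A × Y  into B × Y induced by B⊗g, f⊗Y
    -- (characterised by its two composites, which determine it uniquely).
    PushoutProduct : Set (o ⊔ h ⊔ ℓ)
    PushoutProduct =
      ∀ {A B X Y} (f : Hom A B) (g : Hom X Y) → Cof f → Cof g → W g →
      let po = pushout (f ⊗ id {X}) (id {A} ⊗ g) in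
      (m : Hom (Pushout.Q po) (B ×ₒ Y)) →
      m ∘ Pushout.ι₁ po ≡ id {B} ⊗ g → m ∘ Pushout.ι₂ po ≡ f ⊗ id {Y} →
      Cof m × W m

    1⊔1 : Pushout (¡ {⊤}) (¡ {⊤})
    1⊔1 = pushout ¡ ¡

    [_,_] : ∀ {Z} → Hom ⊤ Z → Hom ⊤ Z → Hom (Pushout.Q 1⊔1) Z
    [ a , b ] = Pushout.copair 1⊔1 a b (trans (¡-unique _) (sym (¡-unique _)))

    GoodCylinder : (I : Obj) → Hom ⊤ I → Hom ⊤ I → Set ℓ
    GoodCylinder I e₀ e₁ = Cof [ e₀ , e₁ ] × W (! {I})

    DisjointEndpoints : (I : Obj) → Hom ⊤ I → Hom ⊤ I → Set (o ⊔ h)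
    DisjointEndpoints I e₀ e₁ = IsInitial (Pullback.P (pullback e₀ e₁))

    RightProper : Set (o ⊔ h ⊔ ℓ)
    RightProper = ∀ {A B C} (f : Hom A C) (g : Hom B C) → Fib f → W g →
                  W (Pullback.p₁ (pullback f g))

record Setting (o h ℓ : Level) : Set (lsuc (o ⊔ h ⊔ ℓ)) where
  field
    𝒞 : Category o h
    lccc : Basic.LCCC 𝒞
    colimits : Basic.FinColimits 𝒞
    model : Basic.ModelStructure 𝒞 ℓ
    cof=mono : Basic.Hyps.CofibrationsAreMonos 𝒞 lccc colimits model
    pushout-product : Basic.Hyps.PushoutProduct 𝒞 lccc colimits model
    I : Category.Obj 𝒞
    e₀ e₁ : Category.Hom 𝒞 (Basic.LCCC.⊤ lccc) I
    good-cylinder : Basic.Hyps.GoodCylinder 𝒞 lccc colimits model I e₀ e₁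
    disjoint-endpoints : Basic.Hyps.DisjointEndpoints 𝒞 lccc colimits model I e₀ e₁
    right-proper : Basic.Hyps.RightProper 𝒞 lccc colimits model

module Theory {o h ℓ} (S : Setting o h ℓ) where
  open Setting S public
  open Category 𝒞 public
  open Basic 𝒞 public
  open LCCC lccc public
  open ModelStructure model public
  open Reindex pullback public
  open Products lccc public
  open IsTerminal ⊤-terminal public
  open Pullback
  open Pushforward

  -- Fibred path object  P^I_C(Y) = [C × I , Y]_C = Π_{π₁} (π₁^* Y)
  module _ {C Y : Obj} (pY : Hom Y C) where
    private
      Y* : Pullback (π₁ {C} {I}) pY
      Y* = pullback π₁ pY
      PF : Pushforward (π₁ {C} {I}) (p₁ Y*)
      PF = pushforward π₁ (p₁ Y*)

    PI : Obj
    PI = Π PF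

    πPI : Hom PI C
    πPI = π PF

    evAll : Hom (P (pullback (π₁ {C} {I}) πPI)) Y
    evAll = p₂ Y* ∘ ε PF

    ev : Hom ⊤ I → Hom PI Y
    ev t = evAll ∘ pair (pullback π₁ πPI) ⟨ πPI , t ∘ ! ⟩ id
                        (trans π₁∘⟨⟩ (sym identityʳ))

  module _ {∂B B Ē : Obj} (i : Hom ∂B B) (p : Hom Ē B) where
    ∂Ē : Obj
    ∂Ē = P (pullback i p)

    p∂ : Hom ∂Ē ∂B
    p∂ = p₁ (pullback i p)

    ι : Hom ∂Ē Ē
    ι = p₂ (pullback i p)

  module Glue {∂B B Ē ∂E : Obj} (i : Hom ∂B B) (p : Hom Ē B) (q : Hom ∂E ∂B)
              (∂w : Hom ∂E (∂Ē i p)) (∂w-over : p∂ i p ∘ ∂w ≡ q) where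
    ΠĒ : Pushforward i (p∂ i p)
    ΠĒ = pushforward i (p∂ i p)

    ΠE : Pushforward i q
    ΠE = pushforward i q

    i*∂w : Hom (Π ΠE) (Π ΠĒ)
    i*∂w = transpose ΠĒ (π ΠE) (∂w ∘ ε ΠE)
             (trans (sym assoc) (trans (cong (_∘ ε ΠE) ∂w-over) (ε-over ΠE)))

    η : Hom Ē (Π ΠĒ)
    η = transpose ΠĒ p id identityʳ

    GluePB : Pullback η i*∂w
    GluePB = pullback η i*∂w

    E : Obj
    E = P GluePB

    w : Hom E Ē
    w = p₁ GluePB

    pE : Hom E B
    pE = p ∘ w

    -- The canonical map k : ∂E → E exhibiting ∂E ≅ i^* E : its Ē-component
    -- is ι ∘ ∂w, and its i_*∂E-component a is the transpose of the
    -- projection i^*(∂E , i ∘ q) → ∂E.  (k is uniquely determined.)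
    record IsGlueIncl (k : Hom ∂E E) : Set h where
      field
        w∘k : w ∘ k ≡ ι i p ∘ ∂w
        a-over : π ΠE ∘ (p₂ GluePB ∘ k) ≡ i ∘ q
        a-ε : ε ΠE ∘ reindex i (p₂ GluePB ∘ k) a-over ≡ p₂ (pullback i (i ∘ q))

  -- Given a square  Y' --k--> Y  over  j : C' → C, the canonical map
  -- κ : P^I_{C'}(Y') → P^I_C(Y) over j is characterised by compatibility
  -- with evaluation (it is uniquely determined by this).
  module _ {C' C Y' Y : Obj} (j : Hom C' C) (pY' : Hom Y' C') (pY : Hom Y C)
           (k : Hom Y' Y) where
    κ×I : (κ : Hom (PI pY') (PI pY)) → πPI pY ∘ κ ≡ j ∘ πPI pY' →
          Hom (P (pullback (π₁ {C'} {I}) (πPI pY'))) (P (pullback (π₁ {C} {I}) (πPI pY)))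
    κ×I κ ov = pair (pullback π₁ (πPI pY)) ((j ⊗ id) ∘ p₁ Q') (κ ∘ p₂ Q') eq
      where
        Q' = pullback (π₁ {C'} {I}) (πPI pY')
        open ≡-Reasoning
        eq : π₁ ∘ ((j ⊗ id) ∘ p₁ Q') ≡ πPI pY ∘ (κ ∘ p₂ Q')
        eq = begin
          π₁ ∘ ((j ⊗ id) ∘ p₁ Q')   ≡⟨ sym assoc ⟩
          (π₁ ∘ (j ⊗ id)) ∘ p₁ Q'   ≡⟨ cong (_∘ p₁ Q') π₁∘⊗ ⟩
          (j ∘ π₁) ∘ p₁ Q'          ≡⟨ assoc ⟩
          j ∘ (π₁ ∘ p₁ Q')          ≡⟨ cong (j ∘_) (commute Q') ⟩
          j ∘ (πPI pY' ∘ p₂ Q')     ≡⟨ sym assoc ⟩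
          (j ∘ πPI pY') ∘ p₂ Q'     ≡⟨ cong (_∘ p₂ Q') (sym ov) ⟩
          (πPI pY ∘ κ) ∘ p₂ Q'      ≡⟨ assoc ⟩
          πPI pY ∘ (κ ∘ p₂ Q')      ∎

    record IsPathReindex (κ : Hom (PI pY') (PI pY)) : Set h where
      field
        over : πPI pY ∘ κ ≡ j ∘ πPI pY'
        ev-compat : evAll pY ∘ κ×I κ over ≡ k ∘ evAll pY'

-- Maps into Glue(f) over B are maps z into Ē together with a lift of i^*z through f.  Hence (2)
-- extends the homotopy ∂Hs along the trivial cofibration ∂Ē × I ∪ Ē × {1} → Ē × I and reads off s
-- from its end at 0.
--
-- For (1), factor the mapping cylinder of ∂w as a cofibration followed by a trivial fibration
-- t : ∂M → ∂Ē, and put M = Glue(t).  The base, the tube and the free end ∂a : ∂E → ∂M of the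
-- cylinder glue to maps Ē → M, E × I → M and a : E → M.  Since ∂w is a homotopy equivalence, ∂a is
-- a trivial cofibration, hence so is a, and therefore so is ∂M ∪ E → M.  Now (∂w ∘ ∂r , ∂w ∘ ∂Hr)
-- extends to a map ∂M → ∂Ē on the mapping cylinder, and that map together with w extends to
-- Λ : M → Ē; restricting Λ to base and tube gives w ∘ r and w ∘ Hr.
module Submission where

open import Defs
open import Level using (_⊔_)
open import Data.Product using (Σ; Σ-syntax; _×_; _,_; proj₁; proj₂)
open import Relation.Binary.PropositionalEquality
  using (_≡_; refl; sym; trans; cong; subst; module ≡-Reasoning)

-- In (1) the homotopy has to start at a map factoring through `w`, and `w` is not a monomorphism,
-- so prescribing `r` and `Hr` together is not an extension problem on `E ×ₒ I` along a cofibration.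
-- A mapping cylinder builds the identification into the domain. It is formed over `∂B` and then
-- glued, since a replacement chosen over `B` would restrict to an uncontrolled object over `∂B`.
--
-- The trivial fibration `t` is there because its lifting property passes to `unglue`, so that M → B
-- lifts against trivial cofibrations. For E → B nothing of the kind is available: every lifting
-- problem over `B` has target Ē or M, and maps into E arise only by gluing.
--
-- That `a` is a weak equivalence is not a matter of 2-out-of-3: M → Ē is one, so this would require
-- the same of `w`. Instead a deformation of ∂M onto ∂E is extended to M.

module Extension {o h ℓ} (S : Setting o h ℓ) where
  open Theory S
  open FinColimits colimits
  open IsInitial ⊥-initial
  open Hyps lccc colimits model using (1⊔1; [_,_])
  open Pullback
  open ≡-Reasoning

  -- Equational calculus of composites, pullbacks, pushouts and products

  pullˡ : ∀ {A B C D} {a : Hom C D} {b : Hom B C} {c : Hom B D} {f : Hom A B} →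
          a ∘ b ≡ c → a ∘ (b ∘ f) ≡ c ∘ f
  pullˡ e = trans (sym assoc) (cong (_∘ _) e)

  extendˡ : ∀ {A B C C' D} {a : Hom C D} {b : Hom B C} {c : Hom C' D} {d : Hom B C'}
            {f : Hom A B} → a ∘ b ≡ c ∘ d → a ∘ (b ∘ f) ≡ c ∘ (d ∘ f)
  extendˡ e = trans (pullˡ e) assoc

  cancelˡ : ∀ {A B C} {a : Hom C B} {b : Hom B C} {f : Hom A B} →
            a ∘ b ≡ id → a ∘ (b ∘ f) ≡ f
  cancelˡ e = trans (pullˡ e) identityˡ

  pullʳ : ∀ {A B C D} {a : Hom C D} {b : Hom B C} {f : Hom A B} {c : Hom A C} →
          b ∘ f ≡ c → (a ∘ b) ∘ f ≡ a ∘ c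
  pullʳ e = trans assoc (cong (_ ∘_) e)

  module _ {A B C} {f : Hom A C} {g : Hom B C} where
    pb-ext : (Q : Pullback f g) → ∀ {Z} {u v : Hom Z (P Q)} →
             p₁ Q ∘ u ≡ p₁ Q ∘ v → p₂ Q ∘ u ≡ p₂ Q ∘ v → u ≡ v
    pb-ext Q {u = u} {v} e₁ e₂ =
      trans (pair-unique Q (extendˡ (commute Q)) u refl refl)
            (sym (pair-unique Q (extendˡ (commute Q)) v (sym e₁) (sym e₂)))

    pair-cong : (Q : Pullback f g) → ∀ {Z} {a a' : Hom Z A} {b b' : Hom Z B}
                {e : f ∘ a ≡ g ∘ b} {e' : f ∘ a' ≡ g ∘ b'} →
                a ≡ a' → b ≡ b' → pair Q a b e ≡ pair Q a' b' e'
    pair-cong Q {e = e} {e'} ea eb =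
      pair-unique Q e' _ (trans (p₁∘pair Q e) ea) (trans (p₂∘pair Q e) eb)

    pair∘ : (Q : Pullback f g) → ∀ {Z V} {a : Hom Z A} {b : Hom Z B} {t : Hom V Z}
            {e : f ∘ a ≡ g ∘ b} {e' : f ∘ (a ∘ t) ≡ g ∘ (b ∘ t)} →
            pair Q a b e ∘ t ≡ pair Q (a ∘ t) (b ∘ t) e'
    pair∘ Q {e = e} {e'} =
      pair-unique Q e' _ (pullˡ (p₁∘pair Q e)) (pullˡ (p₂∘pair Q e))

  po-ext : ∀ {A B C} {c : Hom C A} {d : Hom C B} (Po : Pushout c d) →
           let open Pushout Po in
           ∀ {Z} {u v : Hom Q Z} → u ∘ ι₁ ≡ v ∘ ι₁ → u ∘ ι₂ ≡ v ∘ ι₂ → u ≡ v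
  po-ext Po {u = u} e₁ e₂ =
    trans (copair-unique e u refl refl) (sym (copair-unique e _ (sym e₁) (sym e₂)))
    where
      open Pushout Po renaming (commute to square)
      e = trans assoc (trans (cong (u ∘_) square) (sym assoc))

  π₂∘⟨⟩ : ∀ {Z A B} {a : Hom Z A} {b : Hom Z B} → π₂ ∘ ⟨ a , b ⟩ ≡ b
  π₂∘⟨⟩ {Z} {A} {B} = p₂∘pair (pullback (! {A}) (! {B})) _

  ×-ext : ∀ {Z A B} {u v : Hom Z (A ×ₒ B)} → π₁ ∘ u ≡ π₁ ∘ v → π₂ ∘ u ≡ π₂ ∘ v → u ≡ v
  ×-ext = pb-ext (pullback ! !)

  ⟨⟩∘ : ∀ {V Z A B} {a : Hom Z A} {b : Hom Z B} {t : Hom V Z} →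
        ⟨ a , b ⟩ ∘ t ≡ ⟨ a ∘ t , b ∘ t ⟩
  ⟨⟩∘ = pair∘ (pullback ! !)

  ⟨⟩-cong : ∀ {Z A B} {a a' : Hom Z A} {b b' : Hom Z B} →
            a ≡ a' → b ≡ b' → ⟨ a , b ⟩ ≡ ⟨ a' , b' ⟩
  ⟨⟩-cong refl refl = refl

  ⊗∘⟨⟩ : ∀ {Z A B C D} {f : Hom A B} {g : Hom C D} {a : Hom Z A} {b : Hom Z C} →
         (f ⊗ g) ∘ ⟨ a , b ⟩ ≡ ⟨ f ∘ a , g ∘ b ⟩
  ⊗∘⟨⟩ = trans ⟨⟩∘ (⟨⟩-cong (pullʳ π₁∘⟨⟩) (pullʳ π₂∘⟨⟩))

  ⟨⟩-η : ∀ {Z A B} {u : Hom Z (A ×ₒ B)} → ⟨ π₁ ∘ u , π₂ ∘ u ⟩ ≡ u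
  ⟨⟩-η = ×-ext π₁∘⟨⟩ π₂∘⟨⟩

  ⊗-∘ : ∀ {A A' A'' B B' B''} {f : Hom A A'} {f' : Hom A' A''} {g : Hom B B'} {g' : Hom B' B''} →
        (f' ⊗ g') ∘ (f ⊗ g) ≡ (f' ∘ f) ⊗ (g' ∘ g)
  ⊗-∘ = trans ⊗∘⟨⟩ (⟨⟩-cong (sym assoc) (sym assoc))

  ⊗-cong : ∀ {A B C D} {f f' : Hom A B} {g g' : Hom C D} → f ≡ f' → g ≡ g' → f ⊗ g ≡ f' ⊗ g'
  ⊗-cong refl refl = refl

  !-ext : ∀ {Z} {u v : Hom Z ⊤} → u ≡ v
  !-ext = trans (!-unique _) (sym (!-unique _))

  ¡-ext : ∀ {Z} {u v : Hom ⊥ Z} → u ≡ v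
  ¡-ext = trans (¡-unique _) (sym (¡-unique _))

  at : ∀ {Y} → Hom ⊤ I → Hom Y (Y ×ₒ I)
  at e = ⟨ id , e ∘ ! ⟩

  ⊗-at : ∀ {X Y} {j : Hom X Y} {e : Hom ⊤ I} → (j ⊗ id) ∘ at e ≡ at e ∘ j
  ⊗-at {j = j} {e} = trans ⊗∘⟨⟩ (trans (⟨⟩-cong (trans identityʳ (sym identityˡ)) eq) (sym ⟨⟩∘))
    where
      eq : id ∘ (e ∘ !) ≡ (e ∘ !) ∘ j
      eq = trans identityˡ (sym (pullʳ !-ext))

  π₁-at : ∀ {Y} {e : Hom ⊤ I} → π₁ ∘ at {Y} e ≡ id
  π₁-at = π₁∘⟨⟩

  -- Pushforwards on generalised elements; stability of colimits and effective unions

  module Pushforwards {A B Y} {f : Hom A B} {g : Hom Y A} (PF : Pushforward f g) where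
    open Pushforward PF

    eval : ∀ {V} (b : Hom V A) (t : Hom V Π) → f ∘ b ≡ π ∘ t → Hom V Y
    eval b t e = ε ∘ pair (pullback f π) b t e

    eval-cong : ∀ {V} {b b' : Hom V A} {t t' : Hom V Π}
                {e : f ∘ b ≡ π ∘ t} {e' : f ∘ b' ≡ π ∘ t'} →
                b ≡ b' → t ≡ t' → eval b t e ≡ eval b' t' e'
    eval-cong eb et = cong (ε ∘_) (pair-cong (pullback f π) eb et)

    eval-over : ∀ {V} {b : Hom V A} {t : Hom V Π} {e : f ∘ b ≡ π ∘ t} → g ∘ eval b t e ≡ b
    eval-over {e = e} = trans (pullˡ ε-over) (p₁∘pair (pullback f π) e)

    eval-∘ : ∀ {V V'} {b : Hom V A} {t : Hom V Π} {v : Hom V' V} {e : f ∘ b ≡ π ∘ t}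
             {e' : f ∘ (b ∘ v) ≡ π ∘ (t ∘ v)} → eval b t e ∘ v ≡ eval (b ∘ v) (t ∘ v) e'
    eval-∘ = pullʳ (pair∘ (pullback f π))

    eval-transpose : ∀ {Z V} {z : Hom Z B} {u : Hom (P (pullback f z)) Y}
                     {eu : g ∘ u ≡ p₁ (pullback f z)} {b : Hom V A} {a : Hom V Z}
                     {e : f ∘ b ≡ π ∘ (transpose z u eu ∘ a)} (e' : f ∘ b ≡ z ∘ a) →
                     eval b (transpose z u eu ∘ a) e ≡ u ∘ pair (pullback f z) b a e'
    eval-transpose {z = z} {u} {eu} {b} {a} {e} e' = begin
      ε ∘ pair (pullback f π) b (transpose z u eu ∘ a) e
        ≡⟨ cong (ε ∘_) (sym (pair-unique (pullback f π) e _
             (trans (pullˡ (p₁∘pair (pullback f π) _)) (p₁∘pair (pullback f z) e'))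
             (trans (pullˡ (p₂∘pair (pullback f π) _)) (pullʳ (p₂∘pair (pullback f z) e'))))) ⟩
      ε ∘ (reindex f (transpose z u eu) (transpose-over eu) ∘ pair (pullback f z) b a e')
        ≡⟨ pullˡ (transpose-ε eu) ⟩
      u ∘ pair (pullback f z) b a e' ∎

    -- A point of the pushforward is a section over a fibre of `f`, so evaluation at the generic
    -- point decides equality. Quantifying over the commutation proofs `c` and `c'`, which are
    -- arguments of `eval`, frees callers from matching a particular one.
    Π-ext : ∀ {Z} {z : Hom Z B} {t t' : Hom Z Π} → π ∘ t ≡ z → π ∘ t' ≡ z →
            (∀ c c' → eval (p₁ (pullback f z)) (t ∘ p₂ (pullback f z)) c ≡
                      eval (p₁ (pullback f z)) (t' ∘ p₂ (pullback f z)) c') → t ≡ t'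
    Π-ext {t = t} {t'} e e' eq =
      trans (transpose-unique over t e refl) (sym (transpose-unique over t' e' (sym (eq _ _))))
      where over = trans (pullˡ ε-over) (p₁∘pair (pullback f π) _)

  -- Stability under pullback of (jointly) epimorphic families: maps out of f^*Z
  -- correspond to maps from Z into the pushforward of a constant family.
  module Stability {A B} (f : Hom A B) (T : Obj) where
    PF : Pushforward f (π₁ {A} {T})
    PF = pushforward f π₁
    open Pushforward PF
    open Pushforwards PF

    curry : ∀ {Z} (z : Hom Z B) → Hom (P (pullback f z)) T → Hom Z Π
    curry z u = transpose z ⟨ p₁ (pullback f z) , u ⟩ π₁∘⟨⟩

    curry-over : ∀ {Z} {z : Hom Z B} {u : Hom (P (pullback f z)) T} → π ∘ curry z u ≡ z
    curry-over = transpose-over π₁∘⟨⟩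

    eval-curry : ∀ {Z V} {z : Hom Z B} {u : Hom (P (pullback f z)) T} {b : Hom V A} {a : Hom V Z}
                 {e : f ∘ b ≡ π ∘ (curry z u ∘ a)} (e' : f ∘ b ≡ z ∘ a) →
                 π₂ ∘ eval b (curry z u ∘ a) e ≡ u ∘ pair (pullback f z) b a e'
    eval-curry e' = trans (cong (π₂ ∘_) (eval-transpose e')) (pullˡ π₂∘⟨⟩)

    curry-injective : ∀ {Z} {z : Hom Z B} {u v : Hom (P (pullback f z)) T} →
                      curry z u ≡ curry z v → u ≡ v
    curry-injective {z = z} {u} {v} e = begin
      u                                         ≡⟨ sym (back u) ⟩
      π₂ ∘ eval (p₁ Q) (curry z u ∘ p₂ Q) _     ≡⟨ cong (π₂ ∘_) (eval-cong refl (cong (_∘ p₂ Q) e)) ⟩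
      π₂ ∘ eval (p₁ Q) (curry z v ∘ p₂ Q) _     ≡⟨ back v ⟩
      v ∎
      where
        Q = pullback f z
        ov : (u : Hom (P Q) T) → f ∘ p₁ Q ≡ π ∘ (curry z u ∘ p₂ Q)
        ov u = trans (commute Q) (sym (pullˡ curry-over))
        back : (u : Hom (P Q) T) → π₂ ∘ eval (p₁ Q) (curry z u ∘ p₂ Q) (ov u) ≡ u
        back u = trans (eval-curry (commute Q))
                       (trans (cong (u ∘_) (sym (pair-unique Q _ id identityʳ identityʳ))) identityʳ)

    -- By naturality of currying, precomposition with `a` sees only the part of f^*Z lying over `a`.
    -- Phrasing agreement on generalised elements avoids naming the comparison map between the two
    -- pullbacks.
    curry-∘ : ∀ {Z Z'} {z : Hom Z B} {u v : Hom (P (pullback f z)) T} (a : Hom Z' Z) →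
              (∀ {V} (w : Hom V (P (pullback f z))) (b : Hom V Z') → p₂ (pullback f z) ∘ w ≡ a ∘ b →
                 u ∘ w ≡ v ∘ w) →
              curry z u ∘ a ≡ curry z v ∘ a
    curry-∘ {z = z} {u} {v} a agree =
      Π-ext (pullˡ curry-over) (pullˡ curry-over) λ c c' →
        ×-ext (trans eval-over (sym eval-over))
          (trans (cong (π₂ ∘_) (eval-cong refl assoc))
          (trans (eval-curry {e = trans c (cong (π ∘_) assoc)} e)
          (trans (agree (pair Q _ _ e) (p₂ R) (p₂∘pair Q e))
          (sym (trans (cong (π₂ ∘_) (eval-cong refl assoc))
                      (eval-curry {e = trans c' (cong (π ∘_) assoc)} e))))))
      where
        Q = pullback f z
        R = pullback f (z ∘ a)
        e : f ∘ p₁ R ≡ z ∘ (a ∘ p₂ R)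
        e = trans (commute R) assoc

  -- `X` is the pullback of ⊥ along `f`, and pullback along `f` has a right adjoint: maps out of `X`
  -- correspond to maps out of ⊥ into a pushforward.
  strict-initial : ∀ {X T} → Hom X ⊥ → {g k : Hom X T} → g ≡ k
  strict-initial {X} {T} f {g} {k} =
    begin
      g                ≡⟨ sym (section g) ⟩
      (g ∘ p₁ Q) ∘ s   ≡⟨ cong (_∘ s) (curry-injective {u = g ∘ p₁ Q} {k ∘ p₁ Q} ¡-ext) ⟩
      (k ∘ p₁ Q) ∘ s   ≡⟨ section k ⟩
      k ∎
    where
      open Stability f T
      Q = pullback f id
      e : f ∘ id ≡ id ∘ f
      e = trans identityʳ (sym identityˡ)
      s = pair Q id f e
      section : (g : Hom X T) → (g ∘ p₁ Q) ∘ s ≡ g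
      section g = trans (pullʳ (p₁∘pair Q e)) identityʳ

  -- The legs of a pushout stay jointly epic after pullback along `f`. This serves as a case
  -- distinction on which leg a generalised element of the pushout comes from.
  cover : ∀ {A B C} {c : Hom C A} {d : Hom C B} (Po : Pushout c d) →
          let open Pushout Po in
          ∀ {Z T} (f : Hom Z Q) {g k : Hom Z T} →
          (∀ {V} (v : Hom V Z) (a : Hom V A) → f ∘ v ≡ ι₁ ∘ a → g ∘ v ≡ k ∘ v) →
          (∀ {V} (v : Hom V Z) (b : Hom V B) → f ∘ v ≡ ι₂ ∘ b → g ∘ v ≡ k ∘ v) → g ≡ k
  cover Po {Z} {T} f {g} {k} on₁ on₂ = begin
      g                ≡⟨ sym (section g) ⟩
      (g ∘ p₁ R) ∘ s   ≡⟨ cong (_∘ s) (curry-injective (po-ext Po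
                            (curry-∘ ι₁ (λ w b e → through (on₁ (p₁ R ∘ w) b (fits w b e))))
                            (curry-∘ ι₂ (λ w b e → through (on₂ (p₁ R ∘ w) b (fits w b e)))))) ⟩
      (k ∘ p₁ R) ∘ s   ≡⟨ section k ⟩
      k ∎
    where
      open Pushout Po hiding (commute)
      open Stability f T
      R = pullback f id
      e : f ∘ id ≡ id ∘ f
      e = trans identityʳ (sym identityˡ)
      s = pair R id f e
      section : (g : Hom Z T) → (g ∘ p₁ R) ∘ s ≡ g
      section g = trans (pullʳ (p₁∘pair R e)) identityʳ
      through : ∀ {V} {w : Hom V (P R)} → g ∘ (p₁ R ∘ w) ≡ k ∘ (p₁ R ∘ w) →
                (g ∘ p₁ R) ∘ w ≡ (k ∘ p₁ R) ∘ w
      through x = trans assoc (trans x (sym assoc))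
      fits : ∀ {V X} {ι : Hom X Q} (w : Hom V (P R)) (b : Hom V X) → p₂ R ∘ w ≡ ι ∘ b →
             f ∘ (p₁ R ∘ w) ≡ ι ∘ b
      fits w b x = trans (pullˡ (trans (commute R) identityˡ)) x

  -- Distinguish the legs through which `g` and `k` pass. On equal legs `x` or `y` is mono; on
  -- different legs `m` identifies a point of `X` with one of `Y`, and `intersect` places both in
  -- `D`, where the legs agree.
  effective-union-mono :
    ∀ {D X Y M} {c : Hom D X} {d : Hom D Y} (Po : Pushout c d) →
    let open Pushout Po in
    (x : Hom X M) (y : Hom Y M) → Mono x → Mono y →
    (∀ {V} (a : Hom V X) (b : Hom V Y) → x ∘ a ≡ y ∘ b →
       Σ[ u ∈ Hom V D ] ((c ∘ u ≡ a) × (d ∘ u ≡ b))) →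
    (m : Hom Q M) → m ∘ ι₁ ≡ x → m ∘ ι₂ ≡ y → Mono m
  effective-union-mono {X = X} {Y} {M} {c} {d} Po x y mono-x mono-y intersect m mι₁ mι₂ {Z} g k mg≡mk =
    cover Po g
      (λ v a ga → cover Po (k ∘ v)
        (λ w a' ka → same mono-x mι₁ v a ga w a' ka)
        (λ w b kb → cross v a ga w b kb))
      (λ v b gb → cover Po (k ∘ v)
        (λ w a ka → cross' v b gb w a ka)
        (λ w b' kb → same mono-y mι₂ v b gb w b' kb))
    where
      open Pushout Po renaming (commute to square)
      meet : ∀ {V V' A A'} {ι : Hom A Q} {ι' : Hom A' Q} {s : Hom A M} {s' : Hom A' M} →
             m ∘ ι ≡ s → m ∘ ι' ≡ s' →
             {v : Hom V Z} {a : Hom V A} → g ∘ v ≡ ι ∘ a →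
             {w : Hom V' V} {a' : Hom V' A'} → (k ∘ v) ∘ w ≡ ι' ∘ a' → s ∘ (a ∘ w) ≡ s' ∘ a'
      meet {ι = ι} {ι'} {s} {s'} e e' {v} {a} ga {w} {a'} ka = begin
        s ∘ (a ∘ w)        ≡⟨ sym (pullˡ e) ⟩
        m ∘ (ι ∘ (a ∘ w))  ≡⟨ cong (m ∘_) (sym (extendˡ ga)) ⟩
        m ∘ (g ∘ (v ∘ w))  ≡⟨ extendˡ mg≡mk ⟩
        m ∘ (k ∘ (v ∘ w))  ≡⟨ cong (m ∘_) (trans (sym assoc) ka) ⟩
        m ∘ (ι' ∘ a')      ≡⟨ pullˡ e' ⟩
        s' ∘ a'            ∎
      same : ∀ {A} {ι : Hom A Q} {s : Hom A M} → Mono s → m ∘ ι ≡ s →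
             ∀ {V V'} (v : Hom V Z) (a : Hom V A) → g ∘ v ≡ ι ∘ a →
             (w : Hom V' V) (a' : Hom V' A) → (k ∘ v) ∘ w ≡ ι ∘ a' → (g ∘ v) ∘ w ≡ (k ∘ v) ∘ w
      same {ι = ι} mono-s e v a ga w a' ka =
        trans (trans (cong (_∘ w) ga) assoc)
          (trans (cong (ι ∘_) (mono-s _ _ (meet e e ga ka))) (sym ka))
      glued : ∀ {V} {a : Hom V X} {b : Hom V Y} → x ∘ a ≡ y ∘ b → ι₁ ∘ a ≡ ι₂ ∘ b
      glued {a = a} {b} e with intersect a b e
      ... | u , refl , refl = extendˡ square
      cross : ∀ {V V'} (v : Hom V Z) (a : Hom V X) → g ∘ v ≡ ι₁ ∘ a →
              (w : Hom V' V) (b : Hom V' Y) → (k ∘ v) ∘ w ≡ ι₂ ∘ b → (g ∘ v) ∘ w ≡ (k ∘ v) ∘ w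
      cross v a ga w b kb =
        trans (trans (cong (_∘ w) ga) assoc) (trans (glued (meet mι₁ mι₂ ga kb)) (sym kb))
      cross' : ∀ {V V'} (v : Hom V Z) (b : Hom V Y) → g ∘ v ≡ ι₂ ∘ b →
               (w : Hom V' V) (a : Hom V' X) → (k ∘ v) ∘ w ≡ ι₁ ∘ a → (g ∘ v) ∘ w ≡ (k ∘ v) ∘ w
      cross' v b gb w a ka =
        trans (trans (cong (_∘ w) gb) assoc)
          (trans (sym (glued (sym (meet mι₂ mι₁ gb ka)))) (sym ka))

  -- Lifting properties and weak equivalences

  -- Used in place of `Fib` because they compose and pull back by direct argument, and because for
  -- glued maps only the lifting property is established.
  LiftsCof LiftsTCof : ∀ {X Y} → Hom X Y → Set _
  LiftsCof g = ∀ {A B} {j : Hom A B} → Cof j → HasLift j g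
  LiftsTCof g = ∀ {A B} {j : Hom A B} → Cof j → W j → HasLift j g

  -- The retract argument: a lift against the second factor of its own factorisation exhibits `f` as
  -- a retract of the first.
  llp⇒Cof : ∀ {A B} {f : Hom A B} →
            (∀ {X Y} {g : Hom X Y} → Fib g → W g → HasLift f g) → Cof f
  llp⇒Cof {f = f} lift with factor-Cof-TFib f
  ... | M , c , p , pc , cof-c , fib-p , w-p with lift fib-p w-p c id (trans pc (sym identityˡ))
  ... | d , df , pd = Cof-retract record
    { s₀ = id ; r₀ = id ; s₁ = d ; r₁ = p ; r₀∘s₀ = identityˡ ; r₁∘s₁ = pd
    ; sq-s = trans identityʳ (sym df) ; sq-r = trans identityʳ (sym pc) } cof-c

  llp⇒TCof : ∀ {A B} {f : Hom A B} →
             (∀ {X Y} {g : Hom X Y} → Fib g → HasLift f g) → Cof f × W f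
  llp⇒TCof {f = f} lift with factor-TCof-Fib f
  ... | M , c , p , pc , cof-c , w-c , fib-p with lift fib-p c id (trans pc (sym identityˡ))
  ... | d , df , pd = Cof-retract r cof-c , W-retract r w-c
    where
      r = record
        { s₀ = id ; r₀ = id ; s₁ = d ; r₁ = p ; r₀∘s₀ = identityˡ ; r₁∘s₁ = pd
        ; sq-s = trans identityʳ (sym df) ; sq-r = trans identityʳ (sym pc) }

  LiftsCof⇒W : ∀ {X Y} {g : Hom X Y} → LiftsCof g → W g
  LiftsCof⇒W {g = g} lift with factor-Cof-TFib g
  ... | M , c , p , pc , cof-c , fib-p , w-p with lift cof-c id p (trans identityʳ (sym pc))
  ... | d , dc , gd = W-retract record
    { s₀ = c ; r₀ = d ; s₁ = id ; r₁ = id ; r₀∘s₀ = dc ; r₁∘s₁ = identityˡ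
    ; sq-s = trans pc (sym identityˡ) ; sq-r = trans gd (sym identityˡ) } w-p

  -- 2-out-of-3 yields identities once some weak equivalence `c` out of `A` is known: cancel it from
  -- `c ∘ id`. A factorisation supplies such a `c`.
  W-id : ∀ {A} → W (id {A})
  W-id {A} with factor-TCof-Fib (id {A})
  ... | M , c , _ , _ , _ , w-c , _ = W-cancelˡ (subst W (sym identityʳ) w-c) w-c

  HasLift-∘ : ∀ {A B X Y Z} {j : Hom A B} {g : Hom X Y} {k : Hom Y Z} →
              HasLift j g → HasLift j k → HasLift j (k ∘ g)
  HasLift-∘ {g = g} lg lk u v e with lk (g ∘ u) v (trans (sym assoc) e)
  ... | d , dj , kd with lg u d (sym dj)
  ... | d' , d'j , gd' = d' , d'j , trans (pullʳ gd') kd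

  HasLift-pullback : ∀ {A B X Y Y'} {j : Hom A B} {g : Hom X Y} (f : Hom Y' Y) →
                     HasLift j g → HasLift j (p₁ (pullback f g))
  HasLift-pullback {j = j} {g} f lg u v e
    with lg (p₂ Q ∘ u) (f ∘ v) (trans (sym (extendˡ (commute Q))) (trans (cong (f ∘_) e) (sym assoc)))
    where Q = pullback f g
  ... | d , dj , gd =
    pair Q v d (sym gd) ,
    pb-ext Q (trans (pullˡ (p₁∘pair Q _)) (sym e)) (trans (pullˡ (p₂∘pair Q _)) dj) ,
    p₁∘pair Q _
    where Q = pullback f g

  HasLift-pushout : ∀ {A B C X Y} {c : Hom C A} {d : Hom C B} {g : Hom X Y} (Po : Pushout c d) →
                    HasLift c g → HasLift (Pushout.ι₂ Po) g
  HasLift-pushout {d = d} {g} Po lc u v e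
    with lc (u ∘ d) (v ∘ ι₁) (trans (extendˡ e) (sym (pullʳ square)))
    where open Pushout Po renaming (commute to square)
  ... | l , lc≡ , gl =
    copair l u lc≡ , copair∘ι₂ lc≡ ,
    po-ext Po (trans (pullʳ (copair∘ι₁ lc≡)) gl) (trans (pullʳ (copair∘ι₂ lc≡)) e)
    where open Pushout Po

  Cof⇒Mono : ∀ {A B} {f : Hom A B} → Cof f → Mono f
  Cof⇒Mono {f = f} = proj₁ (cof=mono f)

  Mono⇒Cof : ∀ {A B} {f : Hom A B} → Mono f → Cof f
  Mono⇒Cof {f = f} = proj₂ (cof=mono f)

  ¡-Cof : ∀ {A} → Cof (¡ {A})
  ¡-Cof = Mono⇒Cof λ g k _ → strict-initial g

  point-TCof : (e : Hom ⊤ I) → Cof e × W e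
  point-TCof e = Mono⇒Cof (λ _ _ _ → !-ext) ,
                 W-cancelˡ (subst W !-ext W-id) (proj₂ good-cylinder)

  -- Pushout-products, homotopy extension and homotopy equivalences

  pushout-product-lift :
    ∀ {A B X Y Z T} {f : Hom A B} {g : Hom X Y} {k : Hom Z T} → Cof f → Cof g → W g → LiftsTCof k →
    (b : Hom (B ×ₒ X) Z) (a : Hom (A ×ₒ Y) Z) (v : Hom (B ×ₒ Y) T) →
    b ∘ (f ⊗ id) ≡ a ∘ (id ⊗ g) → k ∘ b ≡ v ∘ (id ⊗ g) → k ∘ a ≡ v ∘ (f ⊗ id) →
    Σ[ d ∈ Hom (B ×ₒ Y) Z ] ((d ∘ (id ⊗ g) ≡ b) × (d ∘ (f ⊗ id) ≡ a) × (k ∘ d ≡ v))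
  pushout-product-lift {A} {B} {X} {Y} {Z} {T} {f} {g} {k} cof-f cof-g w-g lift b a v ba kb ka =
    conclude (lift (proj₁ m-TCof) (proj₂ m-TCof) (copair b a ba) v (po-ext Po on₁ on₂))
    where
      Po : Pushout (f ⊗ id {X}) (id {A} ⊗ g)
      Po = pushout (f ⊗ id {X}) (id {A} ⊗ g)
      open Pushout Po renaming (commute to square)
      sq : (id {B} ⊗ g) ∘ (f ⊗ id {X}) ≡ (f ⊗ id {Y}) ∘ (id {A} ⊗ g)
      sq = trans ⊗-∘ (trans (⊗-cong (trans identityˡ (sym identityʳ)) (trans identityʳ (sym identityˡ)))
                            (sym ⊗-∘))
      m : Hom Q (B ×ₒ Y)
      m = copair (id ⊗ g) (f ⊗ id) sq
      m-TCof : Cof m × W m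
      m-TCof = pushout-product f g cof-f cof-g w-g m (copair∘ι₁ sq) (copair∘ι₂ sq)
      on₁ : (k ∘ copair b a ba) ∘ ι₁ ≡ (v ∘ m) ∘ ι₁
      on₁ = trans (pullʳ (copair∘ι₁ ba)) (trans kb (sym (pullʳ (copair∘ι₁ sq))))
      on₂ : (k ∘ copair b a ba) ∘ ι₂ ≡ (v ∘ m) ∘ ι₂
      on₂ = trans (pullʳ (copair∘ι₂ ba)) (trans ka (sym (pullʳ (copair∘ι₂ sq))))
      conclude : Σ[ d ∈ Hom (B ×ₒ Y) Z ] ((d ∘ m ≡ copair b a ba) × (k ∘ d ≡ v)) →
                 Σ[ d ∈ Hom (B ×ₒ Y) Z ] ((d ∘ (id ⊗ g) ≡ b) × (d ∘ (f ⊗ id) ≡ a) × (k ∘ d ≡ v))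
      conclude (d , dm , kd) =
        d , trans (sym (pullʳ (copair∘ι₁ sq))) (trans (cong (_∘ ι₁) dm) (copair∘ι₁ ba)) ,
            trans (sym (pullʳ (copair∘ι₂ sq))) (trans (cong (_∘ ι₂) dm) (copair∘ι₂ ba)) , kd

  at-π₁ : ∀ {Y} {e : Hom ⊤ I} → at e ∘ π₁ ≡ id {Y} ⊗ e
  at-π₁ = trans ⟨⟩∘ (⟨⟩-cong refl (pullʳ !-ext))

  ⊗-graph : ∀ {Y} {e : Hom ⊤ I} → (id {Y} ⊗ e) ∘ ⟨ id , ! ⟩ ≡ at e
  ⊗-graph = trans ⊗∘⟨⟩ (⟨⟩-cong identityˡ refl)

  -- The trivial cofibration is the endpoint `e`, so the pushout-product is taken with `j`. Its
  -- domain contains `Y ×ₒ ⊤` in place of `Y`, hence the passage between `at e` and `id ⊗ e`.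
  homotopy-extension :
    ∀ {X Y M N} {j : Hom X Y} {k : Hom M N} (e : Hom ⊤ I) → Cof j → LiftsTCof k →
    (a : Hom (X ×ₒ I) M) (b : Hom Y M) (v : Hom (Y ×ₒ I) N) →
    a ∘ at e ≡ b ∘ j → k ∘ a ≡ v ∘ (j ⊗ id) → k ∘ b ≡ v ∘ at e →
    Σ[ d ∈ Hom (Y ×ₒ I) M ] ((d ∘ at e ≡ b) × (d ∘ (j ⊗ id) ≡ a) × (k ∘ d ≡ v))
  homotopy-extension {X} {Y} {M} {N} {j} {k} e cof-j lift a b v ab ka kb =
    conclude (pushout-product-lift cof-j (proj₁ (point-TCof e)) (proj₂ (point-TCof e)) lift
                (b ∘ π₁) a v on-corner over-end ka)
    where
      on-corner : (b ∘ π₁ {Y} {⊤}) ∘ (j ⊗ id) ≡ a ∘ (id ⊗ e)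
      on-corner = trans (pullʳ π₁∘⟨⟩) (trans (pullˡ (sym ab)) (pullʳ at-π₁))
      over-end : k ∘ (b ∘ π₁ {Y} {⊤}) ≡ v ∘ (id ⊗ e)
      over-end = trans (extendˡ kb) (cong (v ∘_) at-π₁)
      conclude : Σ[ d ∈ Hom (Y ×ₒ I) M ] ((d ∘ (id ⊗ e) ≡ b ∘ π₁) × (d ∘ (j ⊗ id) ≡ a) × (k ∘ d ≡ v)) →
                 Σ[ d ∈ Hom (Y ×ₒ I) M ] ((d ∘ at e ≡ b) × (d ∘ (j ⊗ id) ≡ a) × (k ∘ d ≡ v))
      conclude (d , d₁ , d₂ , kd) =
        d , trans (cong (d ∘_) (sym ⊗-graph)) (trans (pullˡ d₁) (trans (pullʳ π₁∘⟨⟩) identityʳ)) ,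
        d₂ , kd

  -- Homotopy extension along ⊥ → Y, where strictness of ⊥ makes the data on the tube vacuous.
  at-TCof : ∀ {Y} (e : Hom ⊤ I) → Cof (at {Y} e) × W (at {Y} e)
  at-TCof e = llp⇒TCof λ fib-g u v gu →
    let d , d₁ , _ , gd = homotopy-extension e ¡-Cof (λ cof-j w-j → lift-TCof-Fib cof-j w-j fib-g)
                            (¡ ∘ π₁) u v (strict-initial id) (strict-initial π₁) gu
    in d , d₁ , gd

  -- Each end differs from `H` by a trivial cofibration `at`, so 2-out-of-3 passes from one end to
  -- `H` and from `H` to the other.
  homotopic-W : ∀ {Y M} (H : Hom (Y ×ₒ I) M) {e e' : Hom ⊤ I} → W (H ∘ at e) → W (H ∘ at e')
  homotopic-W H {e} {e'} w = W-∘ (proj₂ (at-TCof e')) (W-cancelʳ w (proj₂ (at-TCof e)))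

  -- Replacing f by a fibration t, the homotopy lifts, so that t acquires a strict section σ.
  -- Then σ ∘ t is a weak equivalence by 2-out-of-3, and t is a retract of it.
  homotopy-section-W :
    ∀ {X Y} {f : Hom X Y} {r : Hom Y X} (s : Hom Y X) (H : Hom (Y ×ₒ I) Y) →
    H ∘ at e₀ ≡ f ∘ s → H ∘ at e₁ ≡ id → W (r ∘ f) → W f
  homotopy-section-W {X} {Y} {f} {r} s H H₀ H₁ w-rf =
    let M , c , t , tc , cof-c , w-c , fib-t = factor-TCof-Fib f
        H' , _ , tH' = lift-TCof-Fib (proj₁ (at-TCof e₀)) (proj₂ (at-TCof e₀)) fib-t (c ∘ s) H
                         (trans (pullˡ tc) (sym H₀))
        w-rt = W-cancelʳ (subst W (trans (cong (r ∘_) (sym tc)) (sym assoc)) w-rf) w-c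
        w-t = retract (H' ∘ at e₁) (trans (pullˡ tH') H₁) w-rt
    in subst W tc (W-∘ w-c w-t)
    where
      retract : ∀ {M} {t : Hom M Y} (σ : Hom Y M) → t ∘ σ ≡ id → W (r ∘ t) → W t
      retract {M} {t} σ tσ w-rt = W-retract record
        { s₀ = id ; r₀ = id ; s₁ = σ ; r₁ = t ; r₀∘s₀ = identityˡ ; r₁∘s₁ = tσ
        ; sq-s = identityʳ ; sq-r = trans identityʳ (sym (cancelˡ tσ)) } w-σt
        where
          -- Because `t ∘ σ` is the identity, precomposing `r ∘ t` with `σ ∘ t` leaves it unchanged,
          -- and `r ∘ t` cancels.
          w-σt : W (σ ∘ t)
          w-σt = W-cancelˡ (subst W (sym (pullʳ (cancelˡ tσ))) w-rt) w-rt

  -- Homotopies with both ends prescribed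

  -- The pushout-product hypothesis has its cofibration on the left and its trivial cofibration on
  -- the right. When the cofibration is the boundary `∂I`, the interval therefore stands on the
  -- left, whereas homotopies carry it on the right.
  swap : ∀ {A B} → Hom (A ×ₒ B) (B ×ₒ A)
  swap = ⟨ π₂ , π₁ ⟩

  swap∘⟨⟩ : ∀ {Z A B} {a : Hom Z A} {b : Hom Z B} → swap ∘ ⟨ a , b ⟩ ≡ ⟨ b , a ⟩
  swap∘⟨⟩ = trans ⟨⟩∘ (⟨⟩-cong π₂∘⟨⟩ π₁∘⟨⟩)

  swap∘⊗ : ∀ {A B C D} {f : Hom A B} {g : Hom C D} → swap ∘ (f ⊗ g) ≡ (g ⊗ f) ∘ swap
  swap∘⊗ = trans swap∘⟨⟩ (sym ⊗∘⟨⟩)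

  swap-involutive : ∀ {A B} → swap ∘ swap ≡ id {A ×ₒ B}
  swap-involutive = trans swap∘⟨⟩ (×-ext (trans π₁∘⟨⟩ (sym identityʳ)) (trans π₂∘⟨⟩ (sym identityʳ)))

  atˡ : ∀ {Z Y} → Hom ⊤ Z → Hom Y (Z ×ₒ Y)
  atˡ e = ⟨ e ∘ ! , id ⟩

  ⊗-atˡ : ∀ {X Y Z Z'} {j : Hom X Y} {f : Hom Z Z'} {e : Hom ⊤ Z} →
          (f ⊗ j) ∘ atˡ e ≡ atˡ (f ∘ e) ∘ j
  ⊗-atˡ = trans ⊗∘⟨⟩ (trans (⟨⟩-cong (trans (sym assoc) (sym (pullʳ !-ext)))
                                     (trans identityʳ (sym identityˡ))) (sym ⟨⟩∘))

  swap-atˡ : ∀ {Y} {e : Hom ⊤ I} → swap ∘ atˡ {I} {Y} e ≡ at e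
  swap-atˡ = swap∘⟨⟩

  swap-at : ∀ {Y} {e : Hom ⊤ I} → swap ∘ at {Y} e ≡ atˡ e
  swap-at = swap∘⟨⟩

  module TwoPoints where
    open Pushout 1⊔1 public renaming (Q to 𝟚; ι₁ to left; ι₂ to right)

    ∂I : Hom 𝟚 I
    ∂I = [ e₀ , e₁ ]

    ∂I∘left : ∂I ∘ left ≡ e₀
    ∂I∘left = copair∘ι₁ _

    ∂I∘right : ∂I ∘ right ≡ e₁
    ∂I∘right = copair∘ι₂ _

    𝟚-ext : ∀ {A T} {g k : Hom (𝟚 ×ₒ A) T} →
            g ∘ atˡ left ≡ k ∘ atˡ left → g ∘ atˡ right ≡ k ∘ atˡ right → g ≡ k
    𝟚-ext {A} {T} {g} {k} eˡ eʳ = cover 1⊔1 π₁ (on eˡ) (on eʳ)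
      where
        on : ∀ {pt : Hom ⊤ 𝟚} → g ∘ atˡ pt ≡ k ∘ atˡ pt →
             ∀ {V} (v : Hom V (𝟚 ×ₒ A)) (a : Hom V ⊤) → π₁ ∘ v ≡ pt ∘ a → g ∘ v ≡ k ∘ v
        on {pt} e v a π₁v = begin
          g ∘ v                    ≡⟨ cong (g ∘_) v≡ ⟩
          g ∘ (atˡ pt ∘ (π₂ ∘ v))  ≡⟨ extendˡ e ⟩
          k ∘ (atˡ pt ∘ (π₂ ∘ v))  ≡⟨ cong (k ∘_) (sym v≡) ⟩
          k ∘ v                    ∎
          where
            v≡ : v ≡ atˡ pt ∘ (π₂ ∘ v)
            v≡ = ×-ext (trans π₁v (sym (trans (pullˡ π₁∘⟨⟩) (pullʳ !-ext))))
                       (sym (cancelˡ π₂∘⟨⟩))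

    module _ {A X : Obj} (x₀ x₁ : Hom A X) where
      open Stability (! {A}) X using (PF; curry; eval-curry)
      open Pushforward PF using (Π; π)
      open Pushforwards PF

      private
        at⊤ : Hom A X → Hom ⊤ Π
        at⊤ x = curry ! (x ∘ π₁)

        e : at⊤ x₀ ∘ ¡ ≡ at⊤ x₁ ∘ ¡
        e = ¡-ext

        both : Hom 𝟚 Π
        both = copair (at⊤ x₀) (at⊤ x₁) e

        eval-at⊤ : (x : Hom A X) (c : ! ∘ id ≡ π ∘ (at⊤ x ∘ !)) → π₂ ∘ eval id (at⊤ x ∘ !) c ≡ x
        eval-at⊤ x c = trans (eval-curry !-ext) (trans (pullʳ π₁∘⟨⟩) identityʳ)

      -- `𝟚 ×ₒ A` is a coproduct of two copies of `A` by cartesian closure: `x₀` and `x₁` become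
      -- points of the exponential, here a pushforward along A → ⊤, are copaired there and
      -- uncurried.
      𝟚-copair : Hom (𝟚 ×ₒ A) X
      𝟚-copair = π₂ ∘ eval π₂ (both ∘ π₁) !-ext

      private
        at-point : (x : Hom A X) (pt : Hom ⊤ 𝟚) → both ∘ pt ≡ at⊤ x → 𝟚-copair ∘ atˡ pt ≡ x
        at-point x pt b =
          trans (pullʳ (trans (eval-∘ {e' = !-ext})
                              (eval-cong {e' = !-ext} π₂∘⟨⟩ (trans (pullʳ π₁∘⟨⟩) (pullˡ b)))))
                (eval-at⊤ x !-ext)

      𝟚-copair∘left : 𝟚-copair ∘ atˡ left ≡ x₀
      𝟚-copair∘left = at-point x₀ left (copair∘ι₁ e)

      𝟚-copair∘right : 𝟚-copair ∘ atˡ right ≡ x₁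
      𝟚-copair∘right = at-point x₁ right (copair∘ι₂ e)

  open TwoPoints hiding (copair; commute; copair∘ι₁; copair∘ι₂; copair-unique)

  ∂I-left : ∀ {A} → (∂I ⊗ id {A}) ∘ atˡ left ≡ atˡ e₀
  ∂I-left = trans ⊗-atˡ (trans identityʳ (cong atˡ ∂I∘left))

  ∂I-right : ∀ {A} → (∂I ⊗ id {A}) ∘ atˡ right ≡ atˡ e₁
  ∂I-right = trans ⊗-atˡ (trans identityʳ (cong atˡ ∂I∘right))

  module _ {Y M N} {k : Hom M N} {y₀ y₁ : Hom Y M} {v : Hom (Y ×ₒ I) N}
           (ky₀ : k ∘ y₀ ≡ v ∘ at e₀) (ky₁ : k ∘ y₁ ≡ v ∘ at e₁) where
    private
      over-ends : k ∘ 𝟚-copair y₀ y₁ ≡ (v ∘ swap) ∘ (∂I ⊗ id)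
      over-ends = 𝟚-ext
        (trans (pullʳ (𝟚-copair∘left y₀ y₁))
          (trans ky₀ (sym (trans (pullʳ ∂I-left) (pullʳ swap-atˡ)))))
        (trans (pullʳ (𝟚-copair∘right y₀ y₁))
          (trans ky₁ (sym (trans (pullʳ ∂I-right) (pullʳ swap-atˡ)))))

      ends : {d : Hom (I ×ₒ Y) M} → d ∘ (∂I ⊗ id) ≡ 𝟚-copair y₀ y₁ →
             ((d ∘ swap) ∘ at e₀ ≡ y₀) × ((d ∘ swap) ∘ at e₁ ≡ y₁)
      ends {d} e =
        trans (pullʳ swap-at) (trans (cong (d ∘_) (sym ∂I-left)) (trans (pullˡ e) (𝟚-copair∘left y₀ y₁))) ,
        trans (pullʳ swap-at) (trans (cong (d ∘_) (sym ∂I-right)) (trans (pullˡ e) (𝟚-copair∘right y₀ y₁)))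

      unswap : {d : Hom (I ×ₒ Y) M} → k ∘ d ≡ v ∘ swap → k ∘ (d ∘ swap) ≡ v
      unswap e = trans (pullˡ e) (trans (pullʳ swap-involutive) identityʳ)

    homotopy-lift-Cof : LiftsCof k →
      Σ[ d ∈ Hom (Y ×ₒ I) M ] ((d ∘ at e₀ ≡ y₀) × (d ∘ at e₁ ≡ y₁) × (k ∘ d ≡ v))
    homotopy-lift-Cof lift =
      let d , d∂ , kd = lift (Mono⇒Cof mono) (𝟚-copair y₀ y₁) (v ∘ swap) over-ends
          d₀ , d₁ = ends d∂
      in d ∘ swap , d₀ , d₁ , unswap kd
      where
        mono : Mono (∂I ⊗ id {Y})
        mono g h e = ×-ext
          (Cof⇒Mono (proj₁ good-cylinder) _ _
            (trans (sym (extendˡ π₁∘⊗)) (trans (cong (π₁ ∘_) e) (extendˡ π₁∘⊗))))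
          (trans (sym (trans (pullˡ π₂∘⟨⟩) (drop-id g))) (trans (cong (π₂ ∘_) e) (trans (pullˡ π₂∘⟨⟩) (drop-id h))))
          where
            drop-id : ∀ {Z} (u : Hom Z (𝟚 ×ₒ Y)) → (id ∘ π₂) ∘ u ≡ π₂ ∘ u
            drop-id u = cong (_∘ u) identityˡ

    -- The pushout-product of `∂I` with `c`. In contrast with `homotopy-extension`, it is `c` that
    -- is trivial, and this is why both ends may be fixed at once.
    homotopy-lift-TCof : ∀ {X} {c : Hom X Y} → Cof c → W c → LiftsTCof k →
      (a : Hom (X ×ₒ I) M) → a ∘ at e₀ ≡ y₀ ∘ c → a ∘ at e₁ ≡ y₁ ∘ c → k ∘ a ≡ v ∘ (c ⊗ id) →
      Σ[ d ∈ Hom (Y ×ₒ I) M ]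
        ((d ∘ at e₀ ≡ y₀) × (d ∘ at e₁ ≡ y₁) × (d ∘ (c ⊗ id) ≡ a) × (k ∘ d ≡ v))
    homotopy-lift-TCof {X} {c} cof-c w-c lift a a₀ a₁ ka =
      let d , dc , d∂ , kd = pushout-product-lift (proj₁ good-cylinder) cof-c w-c lift
                               (a ∘ swap) (𝟚-copair y₀ y₁) (v ∘ swap) corner over-c over-ends
          d₀ , d₁ = ends d∂
      in d ∘ swap , d₀ , d₁ ,
         trans (pullʳ swap∘⊗) (trans (pullˡ dc) (trans (pullʳ swap-involutive) identityʳ)) ,
         unswap kd
      where
        over-c : k ∘ (a ∘ swap) ≡ (v ∘ swap) ∘ (id ⊗ c)
        over-c = trans (pullˡ ka) (trans assoc (sym (pullʳ swap∘⊗)))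
        corner : (a ∘ swap) ∘ (∂I ⊗ id) ≡ 𝟚-copair y₀ y₁ ∘ (id ⊗ c)
        corner = 𝟚-ext
          (trans (trans (pullʳ ∂I-left) (trans (pullʳ swap-atˡ) a₀))
            (sym (trans (pullʳ (trans ⊗-atˡ (cong (λ z → atˡ z ∘ c) identityˡ)))
                        (pullˡ (𝟚-copair∘left y₀ y₁)))))
          (trans (trans (pullʳ ∂I-right) (trans (pullʳ swap-atˡ) a₁))
            (sym (trans (pullʳ (trans ⊗-atˡ (cong (λ z → atˡ z ∘ c) identityˡ)))
                        (pullˡ (𝟚-copair∘right y₀ y₁)))))

  -- Objects over the base and their parts over the boundary

  module Boundary {∂B B : Obj} (i : Hom ∂B B) (mono-i : Mono i) where

    -- j : D → Z exhibits D as the part of (Z , z) lying over ∂B.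
    record Restriction {D Z} (z : Hom Z B) (j : Hom D Z) : Set (o ⊔ h) where
      field
        base : Hom D ∂B
        square : z ∘ j ≡ i ∘ base
        factor : ∀ {V} (a : Hom V Z) (b : Hom V ∂B) → z ∘ a ≡ i ∘ b → Hom V D
        j∘factor : ∀ {V} {a : Hom V Z} {b : Hom V ∂B} (e : z ∘ a ≡ i ∘ b) → j ∘ factor a b e ≡ a
        mono : Mono j

    open Restriction

    pullback-restriction : ∀ {Z} (z : Hom Z B) → Restriction z (p₂ (pullback i z))
    pullback-restriction z = record
      { base = p₁ Q ; square = sym (commute Q)
      ; factor = λ a b e → pair Q b a (sym e) ; j∘factor = λ e → p₂∘pair Q (sym e)
      ; mono = λ g k e → pb-ext Q (mono-i _ _
          (trans (extendˡ (commute Q)) (trans (cong (z ∘_) e) (sym (extendˡ (commute Q)))))) e }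
      where Q = pullback i z

    -- With this instance the gluing principles also construct and compare maps out of objects lying
    -- entirely over `∂B`, such as `∂X` itself.
    id-restriction : ∀ {Z} {z : Hom Z B} {b : Hom Z ∂B} → z ≡ i ∘ b → Restriction z id
    id-restriction {b = b} e = record
      { base = b ; square = trans identityʳ e ; factor = λ a _ _ → a ; j∘factor = λ _ → identityˡ
      ; mono = λ g k e → trans (sym identityˡ) (trans e identityˡ) }

    ⊗-restriction : ∀ {D Z} {z : Hom Z B} {j : Hom D Z} →
                    Restriction z j → Restriction (z ∘ π₁ {Z} {I}) (j ⊗ id)
    ⊗-restriction {z = z} {j} R = record
      { base = base R ∘ π₁
      ; square = trans (pullʳ π₁∘⟨⟩) (extendˡ (square R))
      ; factor = λ a b e → ⟨ factor R (π₁ ∘ a) b (trans (sym assoc) e) , π₂ ∘ a ⟩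
      ; j∘factor = λ e → trans ⊗∘⟨⟩ (trans (⟨⟩-cong (j∘factor R _) identityˡ) ⟨⟩-η)
      ; mono = λ g k e → ×-ext
          (mono R _ _ (trans (sym (extendˡ π₁∘⟨⟩)) (trans (cong (π₁ ∘_) e) (extendˡ π₁∘⟨⟩))))
          (trans (sym (on₂ g)) (trans (cong (π₂ ∘_) e) (on₂ k))) }
      where
        on₂ : ∀ {V} (g : Hom V _) → π₂ ∘ ((j ⊗ id) ∘ g) ≡ π₂ ∘ g
        on₂ g = trans (pullˡ π₂∘⟨⟩) (cong (_∘ g) identityˡ)

    -- The comparison map ∂M ∪ X → M, with union along ∂X, is a trivial cofibration.
    extend-from-union :
      ∀ {∂X X ∂M M N L} {zX : Hom X B} {zM : Hom M B} {kX : Hom ∂X X} {kM : Hom ∂M M}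
        {a : Hom X M} {c : Hom ∂X ∂M} →
      Restriction zM kM → Restriction zX kX → zM ∘ a ≡ zX → a ∘ kX ≡ kM ∘ c →
      Mono a → Cof c → W c → W a → {k : Hom N L} → LiftsTCof k →
      (u : Hom ∂M N) (v : Hom X N) (l : Hom M L) →
      u ∘ c ≡ v ∘ kX → k ∘ u ≡ l ∘ kM → k ∘ v ≡ l ∘ a →
      Σ[ d ∈ Hom M N ] ((d ∘ kM ≡ u) × (d ∘ a ≡ v) × (k ∘ d ≡ l))
    extend-from-union {∂X} {X} {∂M} {M} {N} {L} {zX} {zM} {kX} {kM} {a} {c}
      RM RX a-over square-a mono-a cof-c w-c w-a {k} lift u v l uc ku kv =
      conclude (lift (Mono⇒Cof m-mono) m-W (copair u v uc) l (po-ext Po over₁ over₂))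
      where
        Po : Pushout c kX
        Po = pushout c kX
        open Pushout Po renaming (commute to po-square)
        m-eq : kM ∘ c ≡ a ∘ kX
        m-eq = sym square-a
        m : Hom Q M
        m = copair kM a m-eq
        -- A point of `X` whose image comes from `∂M` lies over `∂B`, hence in `∂X`.
        intersect : ∀ {V} (x : Hom V ∂M) (e : Hom V X) → kM ∘ x ≡ a ∘ e →
                    Σ[ s ∈ Hom V ∂X ] ((c ∘ s ≡ x) × (kX ∘ s ≡ e))
        intersect x e xe = s , mono RM _ _ (begin
            kM ∘ (c ∘ s)  ≡⟨ sym (extendˡ square-a) ⟩
            a ∘ (kX ∘ s)  ≡⟨ cong (a ∘_) (j∘factor RX over) ⟩
            a ∘ e         ≡⟨ sym xe ⟩
            kM ∘ x        ∎) , j∘factor RX over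
          where
            over : zX ∘ e ≡ i ∘ (base RM ∘ x)
            over = trans (sym (pullˡ a-over)) (trans (cong (zM ∘_) (sym xe)) (extendˡ (square RM)))
            s = factor RX e (base RM ∘ x) over
        m-mono : Mono m
        m-mono = effective-union-mono Po kM a (mono RM) mono-a intersect m (copair∘ι₁ m-eq) (copair∘ι₂ m-eq)
        m-W : W m
        -- `a` is `m` after the cobase change of the trivial cofibration `c`.
        m-W = W-cancelʳ (subst W (sym (copair∘ι₂ m-eq)) w-a)
          (proj₂ (llp⇒TCof λ fib-g → HasLift-pushout Po (lift-TCof-Fib cof-c w-c fib-g)))
        over₁ : (k ∘ copair u v uc) ∘ ι₁ ≡ (l ∘ m) ∘ ι₁
        over₁ = trans (pullʳ (copair∘ι₁ uc)) (trans ku (sym (pullʳ (copair∘ι₁ m-eq))))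
        over₂ : (k ∘ copair u v uc) ∘ ι₂ ≡ (l ∘ m) ∘ ι₂
        over₂ = trans (pullʳ (copair∘ι₂ uc)) (trans kv (sym (pullʳ (copair∘ι₂ m-eq))))
        conclude : Σ[ d ∈ Hom M N ] ((d ∘ m ≡ copair u v uc) × (k ∘ d ≡ l)) →
                   Σ[ d ∈ Hom M N ] ((d ∘ kM ≡ u) × (d ∘ a ≡ v) × (k ∘ d ≡ l))
        conclude (d , dm , kd) =
          d , trans (sym (pullʳ (copair∘ι₁ m-eq))) (trans (cong (_∘ ι₁) dm) (copair∘ι₁ uc)) ,
          trans (sym (pullʳ (copair∘ι₂ m-eq))) (trans (cong (_∘ ι₂) dm) (copair∘ι₂ uc)) , kd

    -- The universal property of Glue

    module Gluing {Ē ∂X : Obj} (p : Hom Ē B) (q : Hom ∂X ∂B) (f : Hom ∂X (∂Ē i p))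
                  (f-over : p∂ i p ∘ f ≡ q) where
      open Glue i p q f f-over public renaming (E to X; w to unglue; pE to pX)
      module PX = Pushforward ΠE
      module PĒ = Pushforward ΠĒ
      module EX = Pushforwards ΠE
      module EĒ = Pushforwards ΠĒ

      private
        y : Hom X PX.Π
        y = p₂ GluePB

        i*∂w-over : PĒ.π ∘ i*∂w ≡ PX.π
        i*∂w-over = PĒ.transpose-over _

        η-over : PĒ.π ∘ η ≡ p
        η-over = PĒ.transpose-over identityʳ

        y-over : PX.π ∘ y ≡ pX
        y-over = trans (cong (_∘ y) (sym i*∂w-over))
                   (trans (pullʳ (sym (commute GluePB))) (pullˡ η-over))

        over-eval : ∀ {V} {a : Hom V X} {b : Hom V ∂B} → pX ∘ a ≡ i ∘ b → i ∘ b ≡ PX.π ∘ (y ∘ a)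
        over-eval e = trans (sym e) (sym (pullˡ y-over))

      -- The isomorphism from i^*X to `∂X` on generalised elements: the component in the pushforward
      -- is a section over the fibre of `i`, which is applied at `b`.
      restrict : ∀ {V} (a : Hom V X) (b : Hom V ∂B) → pX ∘ a ≡ i ∘ b → Hom V ∂X
      restrict a b e = EX.eval b (y ∘ a) (over-eval e)

      restrict-cong : ∀ {V} {a a' : Hom V X} {b b' : Hom V ∂B} {e : pX ∘ a ≡ i ∘ b} {e' : pX ∘ a' ≡ i ∘ b'} →
                      a ≡ a' → b ≡ b' → restrict a b e ≡ restrict a' b' e'
      restrict-cong ea eb = EX.eval-cong eb (cong (y ∘_) ea)

      restrict-∘ : ∀ {V V'} {a : Hom V X} {b : Hom V ∂B} {v : Hom V' V} {e : pX ∘ a ≡ i ∘ b}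
                   {e' : pX ∘ (a ∘ v) ≡ i ∘ (b ∘ v)} → restrict a b e ∘ v ≡ restrict (a ∘ v) (b ∘ v) e'
      restrict-∘ {e' = e'} =
        trans (EX.eval-∘ {e' = trans (over-eval e') (cong (PX.π ∘_) (sym assoc))}) (EX.eval-cong refl assoc)

      restrict-over : ∀ {V} {a : Hom V X} {b : Hom V ∂B} {e : pX ∘ a ≡ i ∘ b} → q ∘ restrict a b e ≡ b
      restrict-over = EX.eval-over

      -- The commuting square of the defining pullback, transposed back along the adjunction and
      -- read at `b`.
      unglue-restrict : ∀ {V} {a : Hom V X} {b : Hom V ∂B} (e : pX ∘ a ≡ i ∘ b) →
                        ι i p ∘ (f ∘ restrict a b e) ≡ unglue ∘ a
      unglue-restrict {a = a} {b} e = begin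
        ι i p ∘ (f ∘ restrict a b e)
          ≡⟨ cong (ι i p ∘_) (trans (sym assoc) (sym (EĒ.eval-transpose (over-eval e)))) ⟩
        ι i p ∘ EĒ.eval b (i*∂w ∘ (y ∘ a)) (trans (over-eval e) (sym (pullˡ i*∂w-over)))
          ≡⟨ cong (ι i p ∘_) (EĒ.eval-cong refl (sym (extendˡ (commute GluePB)))) ⟩
        ι i p ∘ EĒ.eval b (η ∘ (unglue ∘ a)) (trans e' (sym (pullˡ η-over)))
          ≡⟨ cong (ι i p ∘_) (trans (EĒ.eval-transpose e') identityˡ) ⟩
        ι i p ∘ pair (pullback i p) b (unglue ∘ a) e'
          ≡⟨ p₂∘pair (pullback i p) e' ⟩
        unglue ∘ a ∎
        where
          e' : i ∘ b ≡ p ∘ (unglue ∘ a)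
          e' = trans (sym e) assoc

      private
        -- Phrased with `restrict` because `incl` is itself an output of `X-lift`; the form with
        -- `incl` follows as `glue-ext`. Any restriction `j` may replace the chosen pullback, as `s`
        -- translates between them.
        X-ext : ∀ {Z D} {z : Hom Z B} {j : Hom D Z} (R : Restriction z j) {g g' : Hom Z X} →
                pX ∘ g ≡ z → unglue ∘ g ≡ unglue ∘ g' →
                (∀ c c' → restrict (g ∘ j) (base R) c ≡ restrict (g' ∘ j) (base R) c') → g ≡ g'
        X-ext {Z} {D} {z} {j} R {g} {g'} gz ng eq =
          pb-ext GluePB ng (EX.Π-ext (trans (pullˡ y-over) gz) (trans (pullˡ y-over) gz')
            λ c c' → trans (via gz c) (trans (cong (_∘ s) (eq _ _)) (sym (via gz' c'))))
          where
            Q = pullback i z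
            s : Hom (P Q) D
            s = factor R (p₂ Q) (p₁ Q) (sym (commute Q))
            js : j ∘ s ≡ p₂ Q
            js = j∘factor R (sym (commute Q))
            base-s : base R ∘ s ≡ p₁ Q
            base-s = mono-i _ _ (trans (sym (extendˡ (square R))) (trans (cong (z ∘_) js) (sym (commute Q))))
            gz' : pX ∘ g' ≡ z
            gz' = trans (pullʳ (sym ng)) (trans (sym assoc) gz)
            over : {g : Hom Z X} → pX ∘ g ≡ z → pX ∘ (g ∘ j) ≡ i ∘ base R
            over gz = trans (pullˡ gz) (square R)
            via : {g : Hom Z X} (gz : pX ∘ g ≡ z) (c : i ∘ p₁ Q ≡ PX.π ∘ ((y ∘ g) ∘ p₂ Q)) →
                  EX.eval (p₁ Q) ((y ∘ g) ∘ p₂ Q) c ≡ restrict (g ∘ j) (base R) (over gz) ∘ s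
            via {g} gz c = sym (trans (EX.eval-∘ {e' = trans (cong (i ∘_) base-s) (trans c (cong (PX.π ∘_) (sym t≡)))})
                                 (EX.eval-cong base-s t≡))
              where
                t≡ : (y ∘ (g ∘ j)) ∘ s ≡ (y ∘ g) ∘ p₂ Q
                t≡ = trans assoc (trans (cong (y ∘_) (pullʳ js)) (sym assoc))

        -- The pushforward component `T` is the transpose of `u`, moved to the chosen pullback by
        -- `s`. It matches `x` in the pushforward of `∂Ē` because both transpose to the restriction
        -- of `x`.
        X-lift : ∀ {Z D} {z : Hom Z B} {j : Hom D Z} (R : Restriction z j)
                 (x : Hom Z Ē) → p ∘ x ≡ z → (u : Hom D ∂X) → ι i p ∘ (f ∘ u) ≡ x ∘ j →
                 Σ[ g ∈ Hom Z X ] ((unglue ∘ g ≡ x) × (∀ c → restrict (g ∘ j) (base R) c ≡ u))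
        X-lift {Z} {D} {z} {j} R x xz u fu =
          g , p₁∘pair GluePB ηx , λ c →
            trans (EX.eval-cong {e' = c''} refl t≡)
              (trans (EX.eval-transpose (sym (square R))) (trans (pullʳ s-section) identityʳ))
          where
            Q = pullback i z
            s : Hom (P Q) D
            s = factor R (p₂ Q) (p₁ Q) (sym (commute Q))
            js : j ∘ s ≡ p₂ Q
            js = j∘factor R (sym (commute Q))
            s-section : s ∘ pair Q (base R) j (sym (square R)) ≡ id
            s-section = mono R _ _ (trans (pullˡ js) (trans (p₂∘pair Q _) (sym identityʳ)))
            fus : ι i p ∘ (f ∘ (u ∘ s)) ≡ x ∘ p₂ Q
            fus = trans (cong (ι i p ∘_) (sym assoc)) (trans (extendˡ fu) (cong (x ∘_) js))
            -- Lying over `∂B` comes from `fu`: the equation holds after `i`, which is mono.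
            p∂fus : p∂ i p ∘ (f ∘ (u ∘ s)) ≡ p₁ Q
            p∂fus = mono-i _ _ (trans (extendˡ (commute (pullback i p)))
                      (trans (cong (p ∘_) fus) (trans (pullˡ xz) (sym (commute Q)))))
            us-over : q ∘ (u ∘ s) ≡ p₁ Q
            us-over = trans (sym (pullˡ f-over)) p∂fus
            T : Hom Z PX.Π
            T = PX.transpose z (u ∘ s) us-over
            T-over : PX.π ∘ T ≡ z
            T-over = PX.transpose-over us-over
            ηx : η ∘ x ≡ i*∂w ∘ T
            ηx = EĒ.Π-ext (trans (pullˡ η-over) xz) (trans (pullˡ i*∂w-over) T-over) λ c c' →
              begin
                EĒ.eval (p₁ Q) ((η ∘ x) ∘ p₂ Q) c
                  ≡⟨ EĒ.eval-cong {e' = trans c (cong (PĒ.π ∘_) assoc)} refl assoc ⟩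
                EĒ.eval (p₁ Q) (η ∘ (x ∘ p₂ Q)) _
                  ≡⟨ trans (EĒ.eval-transpose x-over) identityˡ ⟩
                pair (pullback i p) (p₁ Q) (x ∘ p₂ Q) x-over
                  ≡⟨ sym (pair-unique (pullback i p) x-over (f ∘ (u ∘ s)) p∂fus fus) ⟩
                f ∘ (u ∘ s)
                  ≡⟨ cong (f ∘_) (sym (trans (EX.eval-transpose (commute Q))
                       (trans (cong ((u ∘ s) ∘_) (sym (pair-unique Q (commute Q) id identityʳ identityʳ)))
                              identityʳ))) ⟩
                f ∘ EX.eval (p₁ Q) (T ∘ p₂ Q) (trans (commute Q) (sym (pullˡ T-over)))
                  ≡⟨ trans (sym assoc) (sym (EĒ.eval-transpose _)) ⟩
                EĒ.eval (p₁ Q) (i*∂w ∘ (T ∘ p₂ Q)) (trans c' (cong (PĒ.π ∘_) assoc))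
                  ≡⟨ EĒ.eval-cong refl (sym assoc) ⟩
                EĒ.eval (p₁ Q) ((i*∂w ∘ T) ∘ p₂ Q) c' ∎
              where
                x-over : i ∘ p₁ Q ≡ p ∘ (x ∘ p₂ Q)
                x-over = trans (commute Q) (sym (pullˡ xz))
            g : Hom Z X
            g = pair GluePB x T ηx
            t≡ : y ∘ (g ∘ j) ≡ T ∘ j
            t≡ = pullˡ (p₂∘pair GluePB ηx)
            c'' : i ∘ base R ≡ PX.π ∘ (T ∘ j)
            c'' = trans (sym (square R)) (sym (pullˡ T-over))

        ιf-over : p ∘ (ι i p ∘ f) ≡ i ∘ q
        ιf-over = trans (sym (extendˡ (commute (pullback i p)))) (cong (i ∘_) f-over)

        abstract
          incl-lift : Σ[ g ∈ Hom ∂X X ]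
                        ((unglue ∘ g ≡ ι i p ∘ f) × (∀ c → restrict (g ∘ id) q c ≡ id))
          incl-lift = X-lift (id-restriction refl) (ι i p ∘ f) ιf-over id
                        (trans (cong (ι i p ∘_) identityʳ) (sym identityʳ))

      incl : Hom ∂X X
      incl = proj₁ incl-lift

      unglue∘incl : unglue ∘ incl ≡ ι i p ∘ f
      unglue∘incl = proj₁ (proj₂ incl-lift)

      incl-over : pX ∘ incl ≡ i ∘ q
      incl-over = trans (pullʳ unglue∘incl) ιf-over

      restrict-incl : restrict incl q incl-over ≡ id
      restrict-incl = trans (restrict-cong {e' = trans (cong (pX ∘_) identityʳ) incl-over} (sym identityʳ) refl)
                            (proj₂ (proj₂ incl-lift) _)

      incl∘restrict : ∀ {V} {a : Hom V X} {b : Hom V ∂B} (e : pX ∘ a ≡ i ∘ b) → incl ∘ restrict a b e ≡ a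
      incl∘restrict {a = a} {b} e =
        X-ext (id-restriction (refl {x = i ∘ b})) over (trans (pullˡ unglue∘incl) (trans assoc (unglue-restrict e)))
          λ c c' → begin
            restrict ((incl ∘ restrict a b e) ∘ id) b c
              ≡⟨ restrict-cong {e' = trans (pullˡ incl-over) assoc} identityʳ (sym restrict-over) ⟩
            restrict (incl ∘ restrict a b e) (q ∘ restrict a b e) _
              ≡⟨ sym (restrict-∘ {e = incl-over}) ⟩
            restrict incl q incl-over ∘ restrict a b e
              ≡⟨ trans (cong (_∘ restrict a b e) restrict-incl) identityˡ ⟩
            restrict a b e
              ≡⟨ restrict-cong (sym identityʳ) refl ⟩
            restrict (a ∘ id) b c' ∎
        where
          over : pX ∘ (incl ∘ restrict a b e) ≡ i ∘ b
          over = trans (pullˡ incl-over) (pullʳ restrict-over)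

      abstract
        -- The isomorphism of i^*X with `∂X` in usable form: on points over `∂B`, `restrict` is
        -- inverse to `incl`.
        incl-restriction : Restriction pX incl
        incl-restriction = record
          { base = q ; square = incl-over ; factor = restrict ; j∘factor = incl∘restrict
          ; mono = λ g k e → trans (sym (retract g)) (trans (restrict-cong {e' = over k} e
              (mono-i _ _ (trans (sym (extendˡ incl-over)) (trans (cong (pX ∘_) e) (extendˡ incl-over)))))
              (retract k)) }
          where
            over : ∀ {V} (g : Hom V ∂X) → pX ∘ (incl ∘ g) ≡ i ∘ (q ∘ g)
            over g = extendˡ incl-over
            retract : ∀ {V} (g : Hom V ∂X) → restrict (incl ∘ g) (q ∘ g) (over g) ≡ g
            retract g = trans (sym restrict-∘) (trans (cong (_∘ g) restrict-incl) identityˡ)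

      glue-ext : ∀ {Z D} {z : Hom Z B} {j : Hom D Z} → Restriction z j → {g g' : Hom Z X} →
                 pX ∘ g ≡ z → unglue ∘ g ≡ unglue ∘ g' → g ∘ j ≡ g' ∘ j → g ≡ g'
      glue-ext R gz ng gj = X-ext R gz ng λ _ _ → restrict-cong gj refl

      abstract
        glue-lift : ∀ {Z D} {z : Hom Z B} {j : Hom D Z} → Restriction z j →
                    (x : Hom Z Ē) → p ∘ x ≡ z → (u : Hom D ∂X) → ι i p ∘ (f ∘ u) ≡ x ∘ j →
                    Σ[ g ∈ Hom Z X ] ((unglue ∘ g ≡ x) × (g ∘ j ≡ incl ∘ u))
        glue-lift {z = z} {j} R x xz u fu =
          let g , ng , gu = X-lift R x xz u fu
              over = trans (pullˡ (trans (pullʳ ng) xz)) (square R)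
          in g , ng , trans (sym (incl∘restrict over)) (cong (incl ∘_) (gu over))

      -- Carries results about the constructed `incl` over to every `k` meeting the specification.
      -- The equation `a-ε` concerns the generic point of a pullback; taking it at the point
      -- `(q , id)` gives `restrict-k`.
      incl-unique : {k : Hom ∂X X} → IsGlueIncl k → k ≡ incl
      incl-unique {k} is = X-ext (id-restriction (refl {x = i ∘ q})) over (trans w∘k (sym unglue∘incl))
        λ c c' → trans (restrict-cong {e' = over} identityʳ refl)
                   (trans restrict-k (trans (sym restrict-incl) (restrict-cong (sym identityʳ) refl)))
        where
          open IsGlueIncl is
          over : pX ∘ k ≡ i ∘ q
          over = trans (pullʳ w∘k) ιf-over
          Q = pullback i (i ∘ q)
          e : i ∘ q ≡ (i ∘ q) ∘ id
          e = sym identityʳ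
          restrict-k : restrict k q over ≡ id
          restrict-k = begin
            PX.ε ∘ pair (pullback i PX.π) q (y ∘ k) _
              ≡⟨ cong (PX.ε ∘_) (sym (pair-unique (pullback i PX.π) _ _
                   (trans (pullˡ (p₁∘pair (pullback i PX.π) _)) (p₁∘pair Q e))
                   (trans (pullˡ (p₂∘pair (pullback i PX.π) _)) (trans (pullʳ (p₂∘pair Q e)) identityʳ)))) ⟩
            PX.ε ∘ (reindex i (y ∘ k) a-over ∘ pair Q q id e)
              ≡⟨ pullˡ a-ε ⟩
            p₂ Q ∘ pair Q q id e
              ≡⟨ p₂∘pair Q e ⟩
            id ∎

  -- Fibred paths as homotopies over the base

  module Paths {C Y : Obj} (pY : Hom Y C) where
    private
      Y* : Pullback (π₁ {C} {I}) pY
      Y* = pullback π₁ pY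

      PF : Pushforward (π₁ {C} {I}) (p₁ Y*)
      PF = pushforward π₁ (p₁ Y*)

      module PF = Pushforward PF
      module EF = Pushforwards PF

      PB : Pullback (π₁ {C} {I}) (πPI pY)
      PB = pullback π₁ (πPI pY)

    uncurry : ∀ {Z} → Hom Z (PI pY) → Hom (Z ×ₒ I) Y
    uncurry t = evAll pY ∘ pair PB ⟨ πPI pY ∘ (t ∘ π₁) , π₂ ⟩ (t ∘ π₁) π₁∘⟨⟩

    -- The `C`-coordinate of `b` is forced by the path, so only the `I`-coordinate remains on the
    -- right.
    evAll-pair : ∀ {V Z} {t : Hom Z (PI pY)} {x : Hom V Z} {b : Hom V (C ×ₒ I)}
                 (c : π₁ ∘ b ≡ πPI pY ∘ (t ∘ x)) →
                 evAll pY ∘ pair PB b (t ∘ x) c ≡ uncurry t ∘ ⟨ x , π₂ ∘ b ⟩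
    evAll-pair {t = t} {x} {b} c = sym (pullʳ (pair-unique PB c _
      (trans (pullˡ (p₁∘pair PB _)) (trans ⟨⟩∘ (trans (⟨⟩-cong
         (trans (pullʳ (pullʳ π₁∘⟨⟩)) (sym c)) π₂∘⟨⟩) ⟨⟩-η)))
      (trans (pullˡ (p₂∘pair PB _)) (pullʳ π₁∘⟨⟩))))

    uncurry-over : ∀ {Z} (t : Hom Z (PI pY)) → pY ∘ uncurry t ≡ (πPI pY ∘ t) ∘ π₁
    uncurry-over t = begin
      pY ∘ uncurry t
        ≡⟨ pullˡ (trans (extendˡ (sym (commute Y*))) (cong (π₁ ∘_) PF.ε-over)) ⟩
      (π₁ ∘ p₁ PB) ∘ pair PB ⟨ πPI pY ∘ (t ∘ π₁) , π₂ ⟩ (t ∘ π₁) π₁∘⟨⟩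
        ≡⟨ pullʳ (p₁∘pair PB _) ⟩
      π₁ ∘ ⟨ πPI pY ∘ (t ∘ π₁) , π₂ ⟩
        ≡⟨ trans π₁∘⟨⟩ (sym assoc) ⟩
      (πPI pY ∘ t) ∘ π₁ ∎

    uncurry-∘ : ∀ {V Z} (t : Hom Z (PI pY)) (x : Hom V Z) → uncurry (t ∘ x) ≡ uncurry t ∘ (x ⊗ id)
    uncurry-∘ t x =
      trans (cong (evAll pY ∘_) (pair-cong PB {e' = trans π₁∘⟨⟩ (cong (πPI pY ∘_) assoc)} refl assoc))
        (trans (evAll-pair _) (cong (uncurry t ∘_) (⟨⟩-cong refl (trans π₂∘⟨⟩ (sym identityˡ)))))

    ev≡uncurry : ∀ {Z} (e : Hom ⊤ I) (t : Hom Z (PI pY)) → ev pY e ∘ t ≡ uncurry t ∘ at e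
    ev≡uncurry e t = begin
      ev pY e ∘ t
        ≡⟨ pullʳ (pair∘ PB {e' = c'}) ⟩
      evAll pY ∘ pair PB (⟨ πPI pY , e ∘ ! ⟩ ∘ t) (id ∘ t) c'
        ≡⟨ cong (evAll pY ∘_) (pair-cong PB refl (trans identityˡ (sym identityʳ))) ⟩
      evAll pY ∘ pair PB (⟨ πPI pY , e ∘ ! ⟩ ∘ t) (t ∘ id) c
        ≡⟨ evAll-pair c ⟩
      uncurry t ∘ ⟨ id , π₂ ∘ (⟨ πPI pY , e ∘ ! ⟩ ∘ t) ⟩
        ≡⟨ cong (uncurry t ∘_) (⟨⟩-cong refl (trans (pullˡ π₂∘⟨⟩) (pullʳ !-ext))) ⟩
      uncurry t ∘ at e ∎
      where
        c : π₁ ∘ (⟨ πPI pY , e ∘ ! ⟩ ∘ t) ≡ πPI pY ∘ (t ∘ id)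
        c = trans (pullˡ π₁∘⟨⟩) (cong (πPI pY ∘_) (sym identityʳ))
        c' : π₁ ∘ (⟨ πPI pY , e ∘ ! ⟩ ∘ t) ≡ πPI pY ∘ (id ∘ t)
        c' = trans (pullˡ π₁∘⟨⟩) (cong (πPI pY ∘_) (sym identityˡ))

    uncurry-injective : ∀ {Z} {t t' : Hom Z (PI pY)} → πPI pY ∘ t ≡ πPI pY ∘ t' →
                        uncurry t ≡ uncurry t' → t ≡ t'
    uncurry-injective {Z} {t} {t'} e eq = EF.Π-ext e refl λ c c' →
      pb-ext Y* (trans EF.eval-over (sym EF.eval-over))
        (trans (via c) (trans (cong (_∘ ⟨ p₂ R , π₂ ∘ p₁ R ⟩) eq) (sym (via c'))))
      where
        R = pullback (π₁ {C} {I}) (πPI pY ∘ t')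
        via : {t : Hom Z (PI pY)} (c : π₁ ∘ p₁ R ≡ PF.π ∘ (t ∘ p₂ R)) →
              p₂ Y* ∘ EF.eval (p₁ R) (t ∘ p₂ R) c ≡ uncurry t ∘ ⟨ p₂ R , π₂ ∘ p₁ R ⟩
        via c = trans (sym assoc) (evAll-pair c)

    module _ {Z : Obj} (c : Hom Z C) (H : Hom (Z ×ₒ I) Y) (over : pY ∘ H ≡ c ∘ π₁) where
      private
        R = pullback (π₁ {C} {I}) c

        H*-over : π₁ ∘ p₁ R ≡ pY ∘ (H ∘ ⟨ p₂ R , π₂ ∘ p₁ R ⟩)
        H*-over = trans (commute R) (sym (trans (extendˡ over) (cong (c ∘_) π₁∘⟨⟩)))

        H* : Hom (P R) (P Y*)
        H* = pair Y* (p₁ R) (H ∘ ⟨ p₂ R , π₂ ∘ p₁ R ⟩) H*-over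

      -- The pullback `R` is Z × I through `⟨ p₂ R , π₂ ∘ p₁ R ⟩`; the path is the transpose of `H`
      -- across this identification.
      path : Hom Z (PI pY)
      path = PF.transpose c H* (p₁∘pair Y* _)

      path-over : πPI pY ∘ path ≡ c
      path-over = PF.transpose-over (p₁∘pair Y* _)

      uncurry-path : uncurry path ≡ H
      uncurry-path = begin
        uncurry path
          ≡⟨ pullʳ (EF.eval-transpose e) ⟩
        p₂ Y* ∘ (H* ∘ pair R b π₁ e)
          ≡⟨ trans (pullˡ (p₂∘pair Y* H*-over)) (pullʳ ⟨⟩∘) ⟩
        H ∘ ⟨ p₂ R ∘ pair R b π₁ e , (π₂ ∘ p₁ R) ∘ pair R b π₁ e ⟩
          ≡⟨ cong (H ∘_) (⟨⟩-cong (p₂∘pair R e) (trans (pullʳ (p₁∘pair R e)) π₂∘⟨⟩)) ⟩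
        H ∘ ⟨ π₁ , π₂ ⟩
          ≡⟨ trans (cong (H ∘_) (×-ext (trans π₁∘⟨⟩ (sym identityʳ)) (trans π₂∘⟨⟩ (sym identityʳ)))) identityʳ ⟩
        H ∎
        where
          b : Hom (Z ×ₒ I) (C ×ₒ I)
          b = ⟨ πPI pY ∘ (path ∘ π₁) , π₂ ⟩
          e : π₁ ∘ b ≡ c ∘ π₁
          e = trans π₁∘⟨⟩ (pullˡ path-over)

      ev-path : (e : Hom ⊤ I) → ev pY e ∘ path ≡ H ∘ at e
      ev-path e = trans (ev≡uncurry e path) (cong (_∘ at e) uncurry-path)

  -- After uncurrying, `ev-compat` turns `κ` into composition with `k`, so statements about any such
  -- `κ` reduce to homotopies.
  uncurry-reindex :
    ∀ {C C' Y Y'} {j : Hom C' C} {pY' : Hom Y' C'} {pY : Hom Y C} {k : Hom Y' Y}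
      {κ : Hom (PI pY') (PI pY)} → IsPathReindex j pY' pY k κ →
    ∀ {Z} (t : Hom Z (PI pY')) → Paths.uncurry pY (κ ∘ t) ≡ k ∘ Paths.uncurry pY' t
  uncurry-reindex {C} {C'} {Y} {Y'} {j} {pY'} {pY} {k} {κ} is {Z} t = sym (begin
    k ∘ (evAll pY' ∘ pair PB' b' (t ∘ π₁) π₁∘⟨⟩)
      ≡⟨ sym (extendˡ ev-compat) ⟩
    evAll pY ∘ (κ×I j pY' pY k κ over ∘ pair PB' b' (t ∘ π₁) π₁∘⟨⟩)
      ≡⟨ cong (evAll pY ∘_) (pair-unique PB π₁∘⟨⟩ _
           (trans (pullˡ (p₁∘pair PB _)) (trans (pullʳ (p₁∘pair PB' _)) (trans ⊗∘⟨⟩ (⟨⟩-cong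
              (trans (sym (extendˡ over)) (cong (πPI pY ∘_) (sym assoc))) identityˡ))))
           (trans (pullˡ (p₂∘pair PB _)) (trans (pullʳ (p₂∘pair PB' _)) (sym assoc)))) ⟩
    Paths.uncurry pY (κ ∘ t) ∎)
    where
      open IsPathReindex is
      PB' = pullback (π₁ {C'} {I}) (πPI pY')
      PB = pullback (π₁ {C} {I}) (πPI pY)
      b' : Hom (Z ×ₒ I) (C' ×ₒ I)
      b' = ⟨ πPI pY' ∘ (t ∘ π₁) , π₂ ⟩

  -- Mapping cylinders

  record MappingCylinder {E Y : Obj} (w : Hom E Y) : Set (o ⊔ h ⊔ ℓ) where
    field
      Cyl : Obj
      retraction : Hom Cyl Y
      base-incl : Hom Y Cyl
      tube : Hom (E ×ₒ I) Cyl
      retraction∘base : retraction ∘ base-incl ≡ id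
      retraction∘tube : retraction ∘ tube ≡ w ∘ π₁
      tube-start : tube ∘ at e₀ ≡ base-incl ∘ w
      retraction-lifts : LiftsCof retraction
      end-Cof : Cof (tube ∘ at e₁)
      -- Expresses that Y ∪ (E × I) → Cyl is a trivial cofibration, through data on base and tube
      -- separately.
      extend : ∀ {N L} {k : Hom N L} → LiftsTCof k →
               (y : Hom Y N) (H : Hom (E ×ₒ I) N) (v : Hom Cyl L) →
               H ∘ at e₀ ≡ y ∘ w → k ∘ y ≡ v ∘ base-incl → k ∘ H ≡ v ∘ tube →
               Σ[ d ∈ Hom Cyl N ] ((d ∘ base-incl ≡ y) × (d ∘ tube ≡ H) × (k ∘ d ≡ v))

    retraction∘end : retraction ∘ (tube ∘ at e₁) ≡ w
    retraction∘end = trans (extendˡ retraction∘tube) (trans (cong (w ∘_) π₁-at) identityʳ)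

    end-W : W w → W (tube ∘ at e₁)
    end-W w-w = W-cancelˡ (subst W (sym retraction∘end) w-w) (LiftsCof⇒W retraction-lifts)

  -- The pushout D = Y ∪ (E × I) glued along w at e₀, followed by a trivial fibration replacement
  -- of D → Y. That the free end E → D is a cofibration is checked by lifting against
  -- trivial fibrations: extend first over Y, then over the tube rel both ends.
  abstract
    mapping-cylinder : ∀ {E Y} (w : Hom E Y) → MappingCylinder w
    mapping-cylinder {E} {Y} w = build (factor-Cof-TFib collapse)
      where
        Po : Pushout (at {E} e₀) w
        Po = pushout (at e₀) w
        open Pushout Po renaming (Q to D; commute to square)
        collapse-eq : (w ∘ π₁) ∘ at e₀ ≡ id ∘ w
        collapse-eq = trans (pullʳ π₁-at) (trans identityʳ (sym identityˡ))
        collapse : Hom D Y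
        collapse = copair (w ∘ π₁) id collapse-eq
        ι₂-TCof : Cof ι₂ × W ι₂
        ι₂-TCof = llp⇒TCof λ fib-g → HasLift-pushout Po
          (lift-TCof-Fib (proj₁ (at-TCof e₀)) (proj₂ (at-TCof e₀)) fib-g)
        -- `collapse` retracts `ι₂`, a cobase change of the trivial cofibration `at e₀`.
        collapse-W : W collapse
        collapse-W = W-cancelʳ (subst W (sym (copair∘ι₂ collapse-eq)) W-id) (proj₂ ι₂-TCof)
        free-end-Cof : Cof (ι₁ ∘ at e₁)
        free-end-Cof = llp⇒Cof λ {_} {_} {g} fib-g w-g u v gu →
          let lifts : LiftsCof g
              lifts = λ cof-j → lift-Cof-TFib cof-j fib-g w-g
              y , _ , gy = lifts ¡-Cof ¡ (v ∘ ι₂) ¡-ext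
              H , H₀ , H₁ , gH = homotopy-lift-Cof {k = g} {y ∘ w} {u} {v ∘ ι₁}
                (trans (extendˡ gy) (trans (cong (v ∘_) (sym square)) (sym assoc)))
                (trans gu (sym assoc)) lifts
          in copair H y H₀ ,
             trans (pullˡ (copair∘ι₁ H₀)) H₁ ,
             po-ext Po (trans (pullʳ (copair∘ι₁ H₀)) gH) (trans (pullʳ (copair∘ι₂ H₀)) gy)
        build : Σ[ M ∈ Obj ] Σ[ c ∈ Hom D M ] Σ[ t ∈ Hom M Y ]
                  ((t ∘ c ≡ collapse) × Cof c × Fib t × W t) → MappingCylinder w
        build (M , c , t , tc , cof-c , fib-t , w-t) = record
          { Cyl = M ; retraction = t ; base-incl = c ∘ ι₂ ; tube = c ∘ ι₁
          ; retraction∘base = trans (pullˡ tc) (copair∘ι₂ collapse-eq)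
          ; retraction∘tube = trans (pullˡ tc) (copair∘ι₁ collapse-eq)
          ; tube-start = trans assoc (trans (cong (c ∘_) square) (sym assoc))
          ; retraction-lifts = λ cof-j → lift-Cof-TFib cof-j fib-t w-t
          ; end-Cof = Mono⇒Cof λ g k e → Cof⇒Mono free-end-Cof g k
              (Cof⇒Mono cof-c _ _ (trans (reassoc g) (trans e (sym (reassoc k)))))
          ; extend = extend }
          where
            reassoc : ∀ {Z} (g : Hom Z E) → c ∘ ((ι₁ ∘ at e₁) ∘ g) ≡ ((c ∘ ι₁) ∘ at e₁) ∘ g
            reassoc g = trans (sym assoc) (cong (_∘ g) (sym assoc))
            -- The factorisation only makes `c` a cofibration; it is also a weak equivalence since
            -- both `collapse` and `t` are.
            c-W : W c
            c-W = W-cancelˡ (subst W (sym tc) collapse-W) w-t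
            extend : ∀ {N L} {k : Hom N L} → LiftsTCof k →
                     (y : Hom Y N) (H : Hom (E ×ₒ I) N) (v : Hom M L) →
                     H ∘ at e₀ ≡ y ∘ w → k ∘ y ≡ v ∘ (c ∘ ι₂) → k ∘ H ≡ v ∘ (c ∘ ι₁) →
                     Σ[ d ∈ Hom M N ] ((d ∘ (c ∘ ι₂) ≡ y) × (d ∘ (c ∘ ι₁) ≡ H) × (k ∘ d ≡ v))
            extend lift y H v H₀ ky kH =
              let d , dc , kd = lift cof-c c-W (copair H y H₀) v
                    (po-ext Po (trans (pullʳ (copair∘ι₁ H₀)) (trans kH (sym assoc)))
                               (trans (pullʳ (copair∘ι₂ H₀)) (trans ky (sym assoc))))
              in d , trans (pullˡ dc) (copair∘ι₂ H₀) , trans (pullˡ dc) (copair∘ι₁ H₀) , kd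

  -- Maps between glued objects

  module GlueMaps {∂B B : Obj} (i : Hom ∂B B) (mono-i : Mono i) {Ē : Obj} (p : Hom Ē B) where
    open Boundary i mono-i
    open Restriction

    ι-restriction : Restriction p (ι i p)
    ι-restriction = pullback-restriction p

    -- Over `∂B` the problem becomes one against `f`, along a pullback of `j`, which is again mono
    -- and hence a cofibration. The lift found there glues with `v`.
    unglue-lifts : ∀ {∂X} {q : Hom ∂X ∂B} {f : Hom ∂X (∂Ē i p)} {f-over : p∂ i p ∘ f ≡ q} →
                   LiftsCof f → LiftsCof (Gluing.unglue p q f f-over)
    unglue-lifts {∂X} {q} {f} {f-over} lift {A} {A'} {j} cof-j u v uv =
      conclude (lift (Mono⇒Cof j∂-mono) u∂ v∂ square∂)
      where
        open Gluing p q f f-over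
        Q = pullback i (p ∘ (v ∘ j))
        Q' = pullback i (p ∘ v)
        j∂-over : i ∘ p₁ Q ≡ (p ∘ v) ∘ (j ∘ p₂ Q)
        j∂-over = trans (commute Q) (trans (cong (_∘ p₂ Q) (sym assoc)) assoc)
        j∂ : Hom (P Q) (P Q')
        j∂ = pair Q' (p₁ Q) (j ∘ p₂ Q) j∂-over
        j∂-square : p₂ Q' ∘ j∂ ≡ j ∘ p₂ Q
        j∂-square = p₂∘pair Q' j∂-over
        j∂-mono : Mono j∂
        j∂-mono g k e = mono (pullback-restriction (p ∘ (v ∘ j))) _ _ (Cof⇒Mono cof-j _ _
          (trans (sym (extendˡ j∂-square)) (trans (cong (p₂ Q' ∘_) e) (extendˡ j∂-square))))
        u-over : pX ∘ (u ∘ p₂ Q) ≡ i ∘ p₁ Q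
        u-over = trans (pullˡ (trans assoc (cong (p ∘_) uv))) (sym (commute Q))
        u∂ : Hom (P Q) ∂X
        u∂ = restrict (u ∘ p₂ Q) (p₁ Q) u-over
        v∂-over : i ∘ p₁ Q' ≡ p ∘ (v ∘ p₂ Q')
        v∂-over = trans (commute Q') assoc
        v∂ : Hom (P Q') (∂Ē i p)
        v∂ = pair (pullback i p) (p₁ Q') (v ∘ p₂ Q') v∂-over
        square∂ : f ∘ u∂ ≡ v∂ ∘ j∂
        square∂ = mono ι-restriction _ _ (begin
          ι i p ∘ (f ∘ u∂)     ≡⟨ unglue-restrict u-over ⟩
          unglue ∘ (u ∘ p₂ Q)  ≡⟨ extendˡ uv ⟩
          v ∘ (j ∘ p₂ Q)       ≡⟨ cong (v ∘_) (sym j∂-square) ⟩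
          v ∘ (p₂ Q' ∘ j∂)     ≡⟨ sym (extendˡ (p₂∘pair (pullback i p) v∂-over)) ⟩
          ι i p ∘ (v∂ ∘ j∂)    ∎)

        conclude : Σ[ d∂ ∈ Hom (P Q') ∂X ] ((d∂ ∘ j∂ ≡ u∂) × (f ∘ d∂ ≡ v∂)) →
                   Σ[ d ∈ Hom A' X ] ((d ∘ j ≡ u) × (unglue ∘ d ≡ v))
        conclude (d∂ , d∂j , fd∂) = conclude' (glue-lift (pullback-restriction (p ∘ v)) v refl d∂
                              (trans (cong (ι i p ∘_) fd∂) (p₂∘pair (pullback i p) v∂-over)))
          where
            conclude' : Σ[ d ∈ Hom A' X ] ((unglue ∘ d ≡ v) × (d ∘ p₂ Q' ≡ incl ∘ d∂)) →
                        Σ[ d ∈ Hom A' X ] ((d ∘ j ≡ u) × (unglue ∘ d ≡ v))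
            conclude' (d , ud , d-incl) = d , dj , ud
              where
                on-∂ : (d ∘ j) ∘ p₂ Q ≡ u ∘ p₂ Q
                on-∂ = begin
                  (d ∘ j) ∘ p₂ Q       ≡⟨ trans (pullʳ (sym j∂-square)) (extendˡ d-incl) ⟩
                  incl ∘ (d∂ ∘ j∂)     ≡⟨ cong (incl ∘_) d∂j ⟩
                  incl ∘ u∂            ≡⟨ incl∘restrict u-over ⟩
                  u ∘ p₂ Q             ∎
                dj : d ∘ j ≡ u
                dj = glue-ext (pullback-restriction (p ∘ (v ∘ j)))
                       (trans assoc (cong (p ∘_) (pullˡ ud)))
                       (trans (pullˡ ud) (sym uv)) on-∂

    module Map {∂E ∂M : Obj} {q : Hom ∂E ∂B} {q' : Hom ∂M ∂B}
               {f : Hom ∂E (∂Ē i p)} {t : Hom ∂M (∂Ē i p)}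
               (f-over : p∂ i p ∘ f ≡ q) (t-over : p∂ i p ∘ t ≡ q')
               (c : Hom ∂E ∂M) (tc : t ∘ c ≡ f) where
      private
        module E = Gluing p q f f-over
        module M = Gluing p q' t t-over

        lifted : Σ[ a ∈ Hom E.X M.X ] ((M.unglue ∘ a ≡ E.unglue) × (a ∘ E.incl ≡ M.incl ∘ c))
        lifted = M.glue-lift E.incl-restriction E.unglue refl c
                   (trans (cong (ι i p ∘_) tc) (sym E.unglue∘incl))

      glue-map : Hom E.X M.X
      glue-map = proj₁ lifted

      unglue∘map : M.unglue ∘ glue-map ≡ E.unglue
      unglue∘map = proj₁ (proj₂ lifted)

      map∘incl : glue-map ∘ E.incl ≡ M.incl ∘ c
      map∘incl = proj₂ (proj₂ lifted)

      map-over : M.pX ∘ glue-map ≡ E.pX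
      map-over = pullʳ unglue∘map

      -- A map into the source is known from its `unglue` part, which `M.unglue` still sees, and
      -- from its part over `∂B`, which the mono `c` recovers.
      glue-map-mono : Mono c → Mono glue-map
      glue-map-mono mono-c g k e =
        E.glue-ext (pullback-restriction (E.pX ∘ g)) refl unglue-g
          (trans (sym (E.incl∘restrict g-over)) (trans (cong (E.incl ∘_) same) (E.incl∘restrict k-over)))
        where
          Q = pullback i (E.pX ∘ g)
          unglue-g : E.unglue ∘ g ≡ E.unglue ∘ k
          unglue-g = trans (sym (pullˡ unglue∘map)) (trans (cong (M.unglue ∘_) e) (pullˡ unglue∘map))
          g-over : E.pX ∘ (g ∘ p₂ Q) ≡ i ∘ p₁ Q
          g-over = trans (sym assoc) (sym (commute Q))
          k-over : E.pX ∘ (k ∘ p₂ Q) ≡ i ∘ p₁ Q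
          k-over = trans (pullˡ (trans (pullʳ (sym unglue-g)) (sym assoc))) (sym (commute Q))
          image : ∀ {g : Hom _ E.X} (over : E.pX ∘ (g ∘ p₂ Q) ≡ i ∘ p₁ Q) →
                  M.incl ∘ (c ∘ E.restrict (g ∘ p₂ Q) (p₁ Q) over) ≡ (glue-map ∘ g) ∘ p₂ Q
          image over = trans (sym (extendˡ map∘incl))
                         (trans (cong (glue-map ∘_) (E.incl∘restrict over)) (sym assoc))
          same : E.restrict (g ∘ p₂ Q) (p₁ Q) g-over ≡ E.restrict (k ∘ p₂ Q) (p₁ Q) k-over
          same = mono-c _ _ (mono M.incl-restriction _ _
            (trans (image g-over) (trans (cong (_∘ p₂ Q) e) (sym (image k-over)))))

      -- A strong deformation retraction of ∂M onto ∂E over ∂B extends to a homotopy on M over B;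
      -- its far end, and its restriction to E, land in E because they do so over ∂B.
      glue-map-W : LiftsTCof p → LiftsTCof q → LiftsTCof q' → LiftsTCof M.unglue →
                   Cof c → W c → W glue-map
      glue-map-W lift-p lift-q lift-q' lift-unglue cof-c w-c =
        retract (lift-q cof-c w-c id q' (trans identityʳ (sym q'c)))
        where
          q'c : q' ∘ c ≡ q
          q'c = trans (cong (_∘ c) (sym t-over)) (trans (pullʳ tc) f-over)

          module Deformation
            (∂ρ : Hom ∂M ∂E) (∂ρc : ∂ρ ∘ c ≡ id)
            (∂G : Hom (∂M ×ₒ I) ∂M) (∂G₀ : ∂G ∘ at e₀ ≡ c ∘ ∂ρ) (∂Gc : ∂G ∘ (c ⊗ id) ≡ c ∘ π₁)
            (G : Hom (M.X ×ₒ I) M.X) (G₁ : G ∘ at e₁ ≡ id) (G-incl : G ∘ (M.incl ⊗ id) ≡ M.incl ∘ ∂G)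
            (pG : M.pX ∘ G ≡ M.pX ∘ π₁) where

            pM-G₀ : M.pX ∘ (G ∘ at e₀) ≡ M.pX
            pM-G₀ = trans (pullˡ pG) (trans (pullʳ π₁-at) identityʳ)

            G₀-incl : (G ∘ at e₀) ∘ M.incl ≡ M.incl ∘ (c ∘ ∂ρ)
            G₀-incl = trans (pullʳ (sym ⊗-at)) (trans (extendˡ G-incl) (cong (M.incl ∘_) ∂G₀))

            ιtc : ∀ {V} (g : Hom V ∂E) → M.unglue ∘ (M.incl ∘ (c ∘ g)) ≡ ι i p ∘ (f ∘ g)
            ιtc g = trans (pullˡ M.unglue∘incl) (trans assoc (cong (ι i p ∘_) (pullˡ tc)))

            far-end : Σ[ ρ ∈ Hom M.X E.X ]
                        ((E.unglue ∘ ρ ≡ M.unglue ∘ (G ∘ at e₀)) × (ρ ∘ M.incl ≡ E.incl ∘ ∂ρ))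
            far-end = E.glue-lift M.incl-restriction (M.unglue ∘ (G ∘ at e₀))
              (trans (sym assoc) pM-G₀) ∂ρ (sym (trans (pullʳ G₀-incl) (ιtc ∂ρ)))

            tube-incl : (G ∘ (glue-map ⊗ id)) ∘ (E.incl ⊗ id) ≡ M.incl ∘ (c ∘ π₁)
            tube-incl = begin
              (G ∘ (glue-map ⊗ id)) ∘ (E.incl ⊗ id)
                ≡⟨ pullʳ (trans ⊗-∘ (trans (⊗-cong map∘incl refl) (sym ⊗-∘))) ⟩
              G ∘ ((M.incl ⊗ id) ∘ (c ⊗ id))
                ≡⟨ trans (pullˡ G-incl) (pullʳ ∂Gc) ⟩
              M.incl ∘ (c ∘ π₁) ∎

            on-E : Σ[ H ∈ Hom (E.X ×ₒ I) E.X ]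
                     ((E.unglue ∘ H ≡ M.unglue ∘ (G ∘ (glue-map ⊗ id))) ×
                      (H ∘ (E.incl ⊗ id) ≡ E.incl ∘ π₁))
            on-E = E.glue-lift (⊗-restriction E.incl-restriction) (M.unglue ∘ (G ∘ (glue-map ⊗ id)))
              (trans (sym assoc) (trans (pullˡ pG) (trans (pullʳ π₁∘⊗) (pullˡ map-over)))) π₁
              (sym (trans (pullʳ tube-incl) (ιtc π₁)))

            conclude : Σ[ ρ ∈ Hom M.X E.X ]
                         ((E.unglue ∘ ρ ≡ M.unglue ∘ (G ∘ at e₀)) × (ρ ∘ M.incl ≡ E.incl ∘ ∂ρ)) →
                       Σ[ H ∈ Hom (E.X ×ₒ I) E.X ]
                         ((E.unglue ∘ H ≡ M.unglue ∘ (G ∘ (glue-map ⊗ id))) ×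
                          (H ∘ (E.incl ⊗ id) ≡ E.incl ∘ π₁)) → W glue-map
            conclude (ρ , uρ , ρ-incl) (H , uH , H-incl) =
              -- `ρ` is used twice: `G` makes it a homotopy section of `glue-map`, and `H` makes it
              -- a homotopy retraction.
              homotopy-section-W ρ G (sym map∘ρ) G₁
                (subst W H₀ (homotopic-W H {e₁} {e₀} (subst W (sym H₁) W-id)))
              where
                map∘ρ : glue-map ∘ ρ ≡ G ∘ at e₀
                map∘ρ = M.glue-ext M.incl-restriction
                  (trans assoc (trans (cong (p ∘_) (trans (pullˡ unglue∘map) uρ)) (trans (sym assoc) pM-G₀)))
                  (trans (pullˡ unglue∘map) uρ)
                  (trans (pullʳ ρ-incl) (trans (extendˡ map∘incl) (sym G₀-incl)))
                unglue-H-at : ∀ e → E.unglue ∘ (H ∘ at e) ≡ M.unglue ∘ ((G ∘ at e) ∘ glue-map)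
                unglue-H-at e = trans (pullˡ uH) (pullʳ (trans (pullʳ ⊗-at) (sym assoc)))
                H-at-incl : ∀ e → (H ∘ at e) ∘ E.incl ≡ E.incl
                H-at-incl e = trans (pullʳ (sym ⊗-at)) (trans (extendˡ H-incl)
                                (trans (cong (E.incl ∘_) π₁-at) identityʳ))
                unglue-H₁ : E.unglue ∘ (H ∘ at e₁) ≡ E.unglue ∘ id
                unglue-H₁ = trans (unglue-H-at e₁) (trans (cong (M.unglue ∘_)
                  (trans (cong (_∘ glue-map) G₁) identityˡ)) (trans unglue∘map (sym identityʳ)))
                H₁ : H ∘ at e₁ ≡ id
                H₁ = E.glue-ext E.incl-restriction
                  (trans assoc (trans (cong (p ∘_) unglue-H₁) (cong (p ∘_) identityʳ)))
                  unglue-H₁ (trans (H-at-incl e₁) (sym identityˡ))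
                unglue-H₀ : E.unglue ∘ (H ∘ at e₀) ≡ E.unglue ∘ (ρ ∘ glue-map)
                unglue-H₀ = trans (unglue-H-at e₀) (sym (trans (pullˡ uρ) assoc))
                H₀ : H ∘ at e₀ ≡ ρ ∘ glue-map
                H₀ = E.glue-ext E.incl-restriction
                  (trans assoc (trans (cong (p ∘_) (trans (unglue-H-at e₀) (sym assoc)))
                    (trans (sym assoc) (trans (cong (_∘ glue-map) (trans (sym assoc) pM-G₀)) map-over))))
                  unglue-H₀
                  (trans (H-at-incl e₀) (sym (trans (pullʳ map∘incl) (trans (extendˡ ρ-incl)
                    (trans (cong (E.incl ∘_) ∂ρc) identityʳ)))))

          extend-over-B :
            (∂ρ : Hom ∂M ∂E) → ∂ρ ∘ c ≡ id →
            Σ[ ∂G ∈ Hom (∂M ×ₒ I) ∂M ]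
              ((∂G ∘ at e₀ ≡ c ∘ ∂ρ) × (∂G ∘ at e₁ ≡ id) × (∂G ∘ (c ⊗ id) ≡ c ∘ π₁) ×
               (q' ∘ ∂G ≡ q' ∘ π₁)) → W glue-map
          extend-over-B ∂ρ ∂ρc (∂G , ∂G₀ , ∂G₁ , ∂Gc , q'∂G) =
            -- The end `e₁` is held at the identity on all of M, so the free end `e₀` is where M is
            -- deformed into E. The lifting property of `M.pX` combines those of `M.unglue` and `p`.
            finish (homotopy-extension {k = M.pX} e₁ (Mono⇒Cof (mono M.incl-restriction)) lift-pM
                      (M.incl ∘ ∂G) id (M.pX ∘ π₁) at-end over-∂ over-end)
            where
              lift-pM : LiftsTCof M.pX
              lift-pM cof-j w-j = HasLift-∘ (lift-unglue cof-j w-j) (lift-p cof-j w-j)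
              at-end : (M.incl ∘ ∂G) ∘ at e₁ ≡ id ∘ M.incl
              at-end = trans (pullʳ ∂G₁) (trans identityʳ (sym identityˡ))
              over-∂ : M.pX ∘ (M.incl ∘ ∂G) ≡ (M.pX ∘ π₁) ∘ (M.incl ⊗ id)
              over-∂ = trans (extendˡ M.incl-over) (trans (cong (i ∘_) q'∂G)
                         (sym (trans (pullʳ π₁∘⊗) (extendˡ M.incl-over))))
              over-end : M.pX ∘ id ≡ (M.pX ∘ π₁) ∘ at e₁
              over-end = trans identityʳ (sym (trans (pullʳ π₁-at) identityʳ))
              finish : Σ[ G ∈ Hom (M.X ×ₒ I) M.X ]
                         ((G ∘ at e₁ ≡ id) × (G ∘ (M.incl ⊗ id) ≡ M.incl ∘ ∂G) ×
                          (M.pX ∘ G ≡ M.pX ∘ π₁)) → W glue-map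
              finish (G , G₁ , G-incl , pG) = conclude far-end on-E
                where open Deformation ∂ρ ∂ρc ∂G ∂G₀ ∂Gc G G₁ G-incl pG

          retract : Σ[ ∂ρ ∈ Hom ∂M ∂E ] ((∂ρ ∘ c ≡ id) × (q ∘ ∂ρ ≡ q')) → W glue-map
          retract (∂ρ , ∂ρc , q∂ρ) = extend-over-B ∂ρ ∂ρc
            (homotopy-lift-TCof {k = q'} {c ∘ ∂ρ} {id} {q' ∘ π₁} over₀ over₁ cof-c w-c lift-q' (c ∘ π₁)
               (trans (pullʳ π₁-at) (trans identityʳ (sym (trans (pullʳ ∂ρc) identityʳ))))
               (trans (pullʳ π₁-at) (trans identityʳ (sym identityˡ)))
               (sym (pullʳ π₁∘⊗)))
            where
              over₀ : q' ∘ (c ∘ ∂ρ) ≡ (q' ∘ π₁) ∘ at e₀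
              over₀ = trans (pullˡ q'c) (trans q∂ρ (sym (trans (pullʳ π₁-at) identityʳ)))
              over₁ : q' ∘ id ≡ (q' ∘ π₁) ∘ at e₁
              over₁ = trans identityʳ (sym (trans (pullʳ π₁-at) identityʳ))

  -- Extending the section and the retraction

  module Equivalence
    {∂B B : Obj} (i : Hom ∂B B) (cof-i : Cof i) {Ē : Obj} (p : Hom Ē B) (fib-p : Fib p)
    {∂E : Obj} (q : Hom ∂E ∂B) (fib-q : Fib q)
    (∂w : Hom ∂E (∂Ē i p)) (∂w-over : p∂ i p ∘ ∂w ≡ q) where

    open Boundary i (Cof⇒Mono cof-i)
    open Restriction using (mono)
    open GlueMaps i (Cof⇒Mono cof-i) p
    open Gluing p q ∂w ∂w-over
      using (X; unglue; pX; incl; incl-over; unglue∘incl; incl-restriction; glue-ext; glue-lift; incl-unique)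

    private
      ∂p : Hom (∂Ē i p) ∂B
      ∂p = p∂ i p

      ιᴱ : Hom (∂Ē i p) Ē
      ιᴱ = ι i p

      lifts-p : LiftsTCof p
      lifts-p cof-j w-j = lift-TCof-Fib cof-j w-j fib-p

      lifts-q : LiftsTCof q
      lifts-q cof-j w-j = lift-TCof-Fib cof-j w-j fib-q

      lifts-∂p : LiftsTCof ∂p
      lifts-∂p cof-j w-j = HasLift-pullback i (lifts-p cof-j w-j)

      ι-over : p ∘ ιᴱ ≡ i ∘ ∂p
      ι-over = sym (commute (pullback i p))

    module Section (∂s : Hom (∂Ē i p) ∂E) (H : Hom (∂Ē i p ×ₒ I) (∂Ē i p)) (H-over : ∂p ∘ H ≡ ∂p ∘ π₁)
                   (H₀ : H ∘ at e₀ ≡ ∂w ∘ ∂s) (H₁ : H ∘ at e₁ ≡ id) where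

      Extended : Set h
      Extended = Σ[ s ∈ Hom Ē X ] Σ[ K ∈ Hom (Ē ×ₒ I) Ē ]
        ((pX ∘ s ≡ p) × (p ∘ K ≡ p ∘ π₁) × (K ∘ at e₀ ≡ unglue ∘ s) × (K ∘ at e₁ ≡ id) ×
         (s ∘ ιᴱ ≡ incl ∘ ∂s) × (K ∘ (ιᴱ ⊗ id) ≡ ιᴱ ∘ H))

      extended : Extended
      extended = build (homotopy-extension {k = p} e₁ (Mono⇒Cof (mono ι-restriction)) lifts-p
                          (ιᴱ ∘ H) id (p ∘ π₁)
                          (trans (pullʳ H₁) (trans identityʳ (sym identityˡ)))
                          (trans (extendˡ ι-over) (trans (cong (i ∘_) H-over)
                            (sym (trans (pullʳ π₁∘⊗) (extendˡ ι-over)))))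
                          (trans identityʳ (sym (trans (pullʳ π₁-at) identityʳ))))
        where
          build : Σ[ K ∈ Hom (Ē ×ₒ I) Ē ]
                    ((K ∘ at e₁ ≡ id) × (K ∘ (ιᴱ ⊗ id) ≡ ιᴱ ∘ H) × (p ∘ K ≡ p ∘ π₁)) → Extended
          build (K , K₁ , K-ι , pK) = glue (glue-lift ι-restriction (K ∘ at e₀) K₀-over ∂s (sym K₀-ι))
            where
              K₀-over : p ∘ (K ∘ at e₀) ≡ p
              K₀-over = trans (pullˡ pK) (trans (pullʳ π₁-at) identityʳ)
              K₀-ι : (K ∘ at e₀) ∘ ιᴱ ≡ ιᴱ ∘ (∂w ∘ ∂s)
              K₀-ι = trans (pullʳ (sym ⊗-at)) (trans (extendˡ K-ι) (cong (ιᴱ ∘_) H₀))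
              glue : Σ[ s ∈ Hom Ē X ] ((unglue ∘ s ≡ K ∘ at e₀) × (s ∘ ιᴱ ≡ incl ∘ ∂s)) → Extended
              glue (s , us , s-ι) =
                s , K , trans (pullʳ us) K₀-over , pK , sym us , K₁ , s-ι , K-ι

    module Retraction (w-∂w : W ∂w) (∂r : Hom (∂Ē i p) ∂E) (∂r-over : q ∘ ∂r ≡ ∂p)
                      (H : Hom (∂E ×ₒ I) ∂E) (H-over : q ∘ H ≡ q ∘ π₁)
                      (H₀ : H ∘ at e₀ ≡ ∂r ∘ ∂w) (H₁ : H ∘ at e₁ ≡ id) where

      Extended : Set h
      Extended = Σ[ r ∈ Hom Ē X ] Σ[ K ∈ Hom (X ×ₒ I) X ]
        ((pX ∘ r ≡ p) × (pX ∘ K ≡ pX ∘ π₁) × (K ∘ at e₀ ≡ r ∘ unglue) × (K ∘ at e₁ ≡ id) ×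
         (r ∘ ιᴱ ≡ incl ∘ ∂r) × (K ∘ (incl ⊗ id) ≡ incl ∘ H))

      private
        open MappingCylinder (mapping-cylinder ∂w)
          renaming (Cyl to ∂M; retraction to t; base-incl to ∂b; tube to ∂γ)

        ∂a : Hom ∂E ∂M
        ∂a = ∂γ ∘ at e₁

        w-∂a : W ∂a
        w-∂a = end-W w-∂w

        module M = Gluing p (∂p ∘ t) t refl
        open Map ∂w-over refl ∂a retraction∘end renaming (glue-map to a)

        a-W : W a
        a-W = glue-map-W lifts-p lifts-q
          (λ cof-j w-j → HasLift-∘ (retraction-lifts cof-j) (lifts-∂p cof-j w-j))
          (λ cof-j _ → unglue-lifts retraction-lifts cof-j) end-Cof w-∂a

        ∂Λ-spec : Set h
        ∂Λ-spec = Σ[ ∂Λ ∈ Hom ∂M (∂Ē i p) ]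
          ((∂Λ ∘ ∂b ≡ ∂w ∘ ∂r) × (∂Λ ∘ ∂γ ≡ ∂w ∘ H) × (∂p ∘ ∂Λ ≡ ∂p ∘ t))

        extend-cylinder : ∂Λ-spec
        extend-cylinder = extend lifts-∂p (∂w ∘ ∂r) (∂w ∘ H) (∂p ∘ t)
          (trans (pullʳ H₀) (sym assoc))
          (trans (pullˡ ∂w-over) (trans ∂r-over (sym (trans (pullʳ retraction∘base) identityʳ))))
          (trans (pullˡ ∂w-over) (trans H-over (sym (trans (pullʳ retraction∘tube) (pullˡ ∂w-over)))))

        Λ-spec : Hom ∂M (∂Ē i p) → Set h
        Λ-spec ∂Λ = Σ[ Λ ∈ Hom M.X Ē ] ((Λ ∘ M.incl ≡ ιᴱ ∘ ∂Λ) × (Λ ∘ a ≡ unglue) × (p ∘ Λ ≡ M.pX))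

        extend-union : ((∂Λ , _) : ∂Λ-spec) → Λ-spec ∂Λ
        extend-union (∂Λ , _ , ∂Λ-γ , p∂Λ) =
          extend-from-union M.incl-restriction incl-restriction map-over map∘incl
            (glue-map-mono (Cof⇒Mono end-Cof)) end-Cof w-∂a a-W {k = p} lifts-p
            (ιᴱ ∘ ∂Λ) unglue M.pX
            -- At the free end the tube `∂w ∘ H` arrives at `∂w` by `H₁`, in agreement with `unglue`
            -- over `∂B`.
            (trans (pullʳ (trans (extendˡ ∂Λ-γ) (trans (cong (∂w ∘_) H₁) identityʳ))) (sym unglue∘incl))
            (trans (extendˡ ι-over) (trans (cong (i ∘_) p∂Λ) (sym M.incl-over)))
            (sym map-over)

        glued-base : Σ[ b ∈ Hom Ē M.X ] ((M.unglue ∘ b ≡ id) × (b ∘ ιᴱ ≡ M.incl ∘ ∂b))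
        glued-base = M.glue-lift ι-restriction id identityʳ ∂b
          (trans (cong (ιᴱ ∘_) retraction∘base) (trans identityʳ (sym identityˡ)))

        glued-tube : Σ[ γ ∈ Hom (X ×ₒ I) M.X ]
                       ((M.unglue ∘ γ ≡ unglue ∘ π₁) × (γ ∘ (incl ⊗ id) ≡ M.incl ∘ ∂γ))
        glued-tube = M.glue-lift (⊗-restriction incl-restriction) (unglue ∘ π₁) (sym assoc) ∂γ
          (trans (cong (ιᴱ ∘_) retraction∘tube) (sym (trans (pullʳ π₁∘⊗) extend-∘)))
          where
            extend-∘ : unglue ∘ (incl ∘ π₁) ≡ ιᴱ ∘ (∂w ∘ π₁)
            extend-∘ = trans (pullˡ unglue∘incl) assoc

        module Conclusion
          (∂Λ : Hom ∂M (∂Ē i p)) (∂Λ-b : ∂Λ ∘ ∂b ≡ ∂w ∘ ∂r) (∂Λ-γ : ∂Λ ∘ ∂γ ≡ ∂w ∘ H)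
          (Λ : Hom M.X Ē) (Λ-incl : Λ ∘ M.incl ≡ ιᴱ ∘ ∂Λ) (Λ-a : Λ ∘ a ≡ unglue) (pΛ : p ∘ Λ ≡ M.pX)
          (b : Hom Ē M.X) (ub : M.unglue ∘ b ≡ id) (b-ι : b ∘ ιᴱ ≡ M.incl ∘ ∂b)
          (γ : Hom (X ×ₒ I) M.X) (uγ : M.unglue ∘ γ ≡ unglue ∘ π₁)
          (γ-incl : γ ∘ (incl ⊗ id) ≡ M.incl ∘ ∂γ) where

          unglue-γ-at : ∀ e → M.unglue ∘ (γ ∘ at e) ≡ unglue
          unglue-γ-at e = trans (pullˡ uγ) (trans (pullʳ π₁-at) identityʳ)

          γ-at-incl : ∀ e → (γ ∘ at e) ∘ incl ≡ M.incl ∘ (∂γ ∘ at e)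
          γ-at-incl e = trans (pullʳ (sym ⊗-at)) (extendˡ γ-incl)

          γ-at-over : ∀ e → M.pX ∘ (γ ∘ at e) ≡ pX
          γ-at-over e = pullʳ (unglue-γ-at e)

          -- Equality in M is tested after `M.unglue` and over `∂B`, so the relations of the
          -- cylinder `∂M` pass to the glued base and tube.
          γ₀ : γ ∘ at e₀ ≡ b ∘ unglue
          γ₀ = M.glue-ext incl-restriction (γ-at-over e₀)
            (trans (unglue-γ-at e₀) (sym (cancelˡ ub)))
            (trans (γ-at-incl e₀) (trans (cong (M.incl ∘_) tube-start)
              (sym (trans (pullʳ unglue∘incl) (extendˡ b-ι)))))

          γ₁ : γ ∘ at e₁ ≡ a
          γ₁ = M.glue-ext incl-restriction (γ-at-over e₁)
            (trans (unglue-γ-at e₁) (sym unglue∘map))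
            (trans (γ-at-incl e₁) (sym map∘incl))

          pΛb : p ∘ (Λ ∘ b) ≡ p
          pΛb = trans (pullˡ pΛ) (trans (pullʳ ub) identityʳ)

          pΛγ : p ∘ (Λ ∘ γ) ≡ pX ∘ π₁
          pΛγ = trans (pullˡ pΛ) (trans (pullʳ uγ) (sym assoc))

          Λb-ι : (Λ ∘ b) ∘ ιᴱ ≡ ιᴱ ∘ (∂w ∘ ∂r)
          Λb-ι = trans (pullʳ b-ι) (trans (extendˡ Λ-incl) (cong (ιᴱ ∘_) ∂Λ-b))

          Λγ-incl : (Λ ∘ γ) ∘ (incl ⊗ id) ≡ ιᴱ ∘ (∂w ∘ H)
          Λγ-incl = trans (pullʳ γ-incl) (trans (extendˡ Λ-incl) (cong (ιᴱ ∘_) ∂Λ-γ))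

          conclude : Σ[ r ∈ Hom Ē X ] ((unglue ∘ r ≡ Λ ∘ b) × (r ∘ ιᴱ ≡ incl ∘ ∂r)) →
                     Σ[ K ∈ Hom (X ×ₒ I) X ] ((unglue ∘ K ≡ Λ ∘ γ) × (K ∘ (incl ⊗ id) ≡ incl ∘ H)) →
                     Extended
          conclude (r , ur , r-ι) (K , uK , K-incl) =
            r , K , trans (pullʳ ur) pΛb , trans (pullʳ uK) pΛγ , K₀ , K₁ , r-ι , K-incl
            where
              K-at-incl : ∀ e → (K ∘ at e) ∘ incl ≡ incl ∘ (H ∘ at e)
              K-at-incl e = trans (pullʳ (sym ⊗-at)) (extendˡ K-incl)
              K-at-over : ∀ e → pX ∘ (K ∘ at e) ≡ pX
              K-at-over e = trans (pullˡ (trans (pullʳ uK) pΛγ)) (trans (pullʳ π₁-at) identityʳ)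
              K₀ : K ∘ at e₀ ≡ r ∘ unglue
              K₀ = glue-ext incl-restriction (K-at-over e₀)
                (trans (pullˡ uK) (trans (pullʳ γ₀) (trans (sym assoc) (sym (pullˡ ur)))))
                (trans (K-at-incl e₀) (trans (cong (incl ∘_) H₀)
                  (sym (trans (pullʳ unglue∘incl) (extendˡ r-ι)))))
              K₁ : K ∘ at e₁ ≡ id
              K₁ = glue-ext incl-restriction (K-at-over e₁)
                (trans (pullˡ uK) (trans (pullʳ γ₁) (trans Λ-a (sym identityʳ))))
                (trans (K-at-incl e₁) (trans (cong (incl ∘_) H₁) (trans identityʳ (sym identityˡ))))

          result : Extended
          -- `Λ` only reaches Ē, but over `∂B` its values on base and tube factor through `∂w` as
          -- `∂w ∘ ∂r` and `∂w ∘ H`; these factorisations are the lifts that gluing asks for.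
          result = conclude (glue-lift ι-restriction (Λ ∘ b) pΛb ∂r (sym Λb-ι))
                            (glue-lift (⊗-restriction incl-restriction) (Λ ∘ γ) pΛγ H (sym Λγ-incl))

        assemble : ((∂Λ , _) : ∂Λ-spec) → Λ-spec ∂Λ →
                   Σ[ b ∈ Hom Ē M.X ] ((M.unglue ∘ b ≡ id) × (b ∘ ιᴱ ≡ M.incl ∘ ∂b)) →
                   Σ[ γ ∈ Hom (X ×ₒ I) M.X ]
                     ((M.unglue ∘ γ ≡ unglue ∘ π₁) × (γ ∘ (incl ⊗ id) ≡ M.incl ∘ ∂γ)) → Extended
        assemble (∂Λ , ∂Λ-b , ∂Λ-γ , _) (Λ , Λ-incl , Λ-a , pΛ) (b , ub , b-ι) (γ , uγ , γ-incl) =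
          Conclusion.result ∂Λ ∂Λ-b ∂Λ-γ Λ Λ-incl Λ-a pΛ b ub b-ι γ uγ γ-incl

      extended : Extended
      extended = assemble extend-cylinder (extend-union extend-cylinder) glued-base glued-tube

    -- Translation back to fibred path objects

    open Glue i p q ∂w ∂w-over using (IsGlueIncl)

    uncurry-at : ∀ {Z C Y} {pY : Hom Y C} (e : Hom ⊤ I) {t : Hom Z (PI pY)} {u : Hom Z Y} →
                 ev pY e ∘ t ≡ u → Paths.uncurry pY t ∘ at e ≡ u
    uncurry-at {pY = pY} e {t} eq = trans (sym (Paths.ev≡uncurry pY e t)) eq

    uncurry-over-base : ∀ {C Y} {pY : Hom Y C} {Z} {z : Hom Z C} {t : Hom Z (PI pY)} → πPI pY ∘ t ≡ z →
                        pY ∘ Paths.uncurry pY t ≡ z ∘ π₁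
    uncurry-over-base {pY = pY} {t = t} eq = trans (Paths.uncurry-over pY t) (cong (_∘ π₁) eq)

    -- Both sides are paths over the same map to `B`, hence comparable as homotopies, where the
    -- equation becomes `Kj`.
    path-restriction :
      ∀ {Z' Z Y' Y} {pY' : Hom Y' ∂B} {pY : Hom Y B} {k : Hom Y' Y} {κ : Hom (PI pY') (PI pY)} →
      IsPathReindex i pY' pY k κ →
      {z' : Hom Z' ∂B} {z : Hom Z B} {j : Hom Z' Z} → z ∘ j ≡ i ∘ z' →
      (t : Hom Z' (PI pY')) → πPI pY' ∘ t ≡ z' →
      (K : Hom (Z ×ₒ I) Y) (over : pY ∘ K ≡ z ∘ π₁) → K ∘ (j ⊗ id) ≡ k ∘ Paths.uncurry pY' t →
      Paths.path pY z K over ∘ j ≡ κ ∘ t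
    path-restriction {pY' = pY'} {pY} {k} {κ} is {z'} {z} {j} zj t t-over K over Kj =
      Paths.uncurry-injective pY
        (trans (pullˡ (Paths.path-over pY z K over))
          (trans zj (sym (trans (extendˡ (IsPathReindex.over is)) (cong (i ∘_) t-over)))))
        (begin
          Paths.uncurry pY (Paths.path pY z K over ∘ j)
            ≡⟨ Paths.uncurry-∘ pY (Paths.path pY z K over) j ⟩
          Paths.uncurry pY (Paths.path pY z K over) ∘ (j ⊗ id)
            ≡⟨ cong (_∘ (j ⊗ id)) (Paths.uncurry-path pY z K over) ⟩
          K ∘ (j ⊗ id)
            ≡⟨ Kj ⟩
          k ∘ Paths.uncurry pY' t
            ≡⟨ sym (uncurry-reindex is t) ⟩
          Paths.uncurry pY (κ ∘ t) ∎)

    -- Pulling back along `i` is encoded by commuting squares with the inclusions of the parts over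
    -- `∂B`, for every `k` and `κ` that qualify as such inclusions.
    SectionOver : Hom (∂Ē i p) ∂E → Hom (∂Ē i p) (PI (p∂ i p)) → Set h
    SectionOver ∂s ∂Hs = Σ[ s ∈ Hom Ē X ] Σ[ Hs ∈ Hom Ē (PI p) ]
      ((pX ∘ s ≡ p) × (πPI p ∘ Hs ≡ p) ×
       (ev p e₀ ∘ Hs ≡ unglue ∘ s) × (ev p e₁ ∘ Hs ≡ id) ×
       ((k : Hom ∂E X) → IsGlueIncl k →
          (s ∘ ι i p ≡ k ∘ ∂s) ×
          ((κ : Hom (PI (p∂ i p)) (PI p)) → IsPathReindex i (p∂ i p) p (ι i p) κ →
             Hs ∘ ι i p ≡ κ ∘ ∂Hs)))

    section-extends :
      (∂s : Hom (∂Ē i p) ∂E) (∂Hs : Hom (∂Ē i p) (PI (p∂ i p))) → πPI (p∂ i p) ∘ ∂Hs ≡ p∂ i p →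
      ev (p∂ i p) e₀ ∘ ∂Hs ≡ ∂w ∘ ∂s → ev (p∂ i p) e₁ ∘ ∂Hs ≡ id → SectionOver ∂s ∂Hs
    section-extends ∂s ∂Hs over at₀ at₁ = conclude extended
      where
        open Section ∂s (Paths.uncurry (p∂ i p) ∂Hs) (uncurry-over-base over)
               (uncurry-at e₀ at₀) (uncurry-at e₁ at₁)
        conclude : Extended → SectionOver ∂s ∂Hs
        conclude (s , K , s-over , K-over , K₀ , K₁ , s-ι , K-ι) =
          s , Hs , s-over , Paths.path-over p p K K-over ,
          trans (Paths.ev-path p p K K-over e₀) K₀ , trans (Paths.ev-path p p K K-over e₁) K₁ ,
          λ k is → trans s-ι (cong (_∘ ∂s) (sym (incl-unique is))) , Hs-ι
          where
            Hs : Hom Ē (PI p)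
            Hs = Paths.path p p K K-over
            Hs-ι : (κ : Hom (PI (p∂ i p)) (PI p)) → IsPathReindex i (p∂ i p) p (ι i p) κ →
                   Hs ∘ ι i p ≡ κ ∘ ∂Hs
            Hs-ι κ is = path-restriction is ι-over ∂Hs over K K-over K-ι

    RetractionOver : Hom (∂Ē i p) ∂E → Hom ∂E (PI q) → Set h
    RetractionOver ∂r ∂Hr = Σ[ r ∈ Hom Ē X ] Σ[ Hr ∈ Hom X (PI pX) ]
      ((pX ∘ r ≡ p) × (πPI pX ∘ Hr ≡ pX) ×
       (ev pX e₀ ∘ Hr ≡ r ∘ unglue) × (ev pX e₁ ∘ Hr ≡ id) ×
       ((k : Hom ∂E X) → IsGlueIncl k →
          (r ∘ ι i p ≡ k ∘ ∂r) ×
          ((κ : Hom (PI q) (PI pX)) → IsPathReindex i q pX k κ →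
             Hr ∘ k ≡ κ ∘ ∂Hr)))

    -- The homotopy section enters this half solely through `W ∂w`, which makes the free end of the
    -- cylinder a trivial cofibration.
    retraction-extends :
      (∂r : Hom (∂Ē i p) ∂E) → q ∘ ∂r ≡ p∂ i p → (∂Hr : Hom ∂E (PI q)) → πPI q ∘ ∂Hr ≡ q →
      ev q e₀ ∘ ∂Hr ≡ ∂r ∘ ∂w → ev q e₁ ∘ ∂Hr ≡ id → W ∂w → RetractionOver ∂r ∂Hr
    retraction-extends ∂r ∂r-over ∂Hr over at₀ at₁ w-∂w = conclude extended
      where
        open Retraction w-∂w ∂r ∂r-over (Paths.uncurry q ∂Hr) (uncurry-over-base over)
               (uncurry-at e₀ at₀) (uncurry-at e₁ at₁)
        conclude : Extended → RetractionOver ∂r ∂Hr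
        conclude (r , K , r-over , K-over , K₀ , K₁ , r-ι , K-incl) =
          r , Hr , r-over , Paths.path-over pX pX K K-over ,
          trans (Paths.ev-path pX pX K K-over e₀) K₀ , trans (Paths.ev-path pX pX K K-over e₁) K₁ ,
          λ k is → trans r-ι (cong (_∘ ∂r) (sym (incl-unique is))) , Hr-k k (incl-unique is)
          where
            Hr : Hom X (PI pX)
            Hr = Paths.path pX pX K K-over
            Hr-k : (k : Hom ∂E X) → k ≡ incl →
                   (κ : Hom (PI q) (PI pX)) → IsPathReindex i q pX k κ → Hr ∘ k ≡ κ ∘ ∂Hr
            Hr-k k k≡incl κ is = path-restriction is
              (trans (cong (pX ∘_) k≡incl) incl-over) ∂Hr over K K-over
              (trans (cong (λ k → K ∘ (k ⊗ id)) k≡incl)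
                (trans K-incl (cong (_∘ Paths.uncurry q ∂Hr) (sym k≡incl))))

    -- The left and right homotopy inverses may differ: `∂r ∘ ∂w` is homotopic to an identity and so
    -- a weak equivalence, and together with the homotopy section `∂s` this suffices.
    boundary-W :
      (∂r : Hom (∂Ē i p) ∂E) (∂Hr : Hom ∂E (PI q)) →
      ev q e₀ ∘ ∂Hr ≡ ∂r ∘ ∂w → ev q e₁ ∘ ∂Hr ≡ id →
      (∂s : Hom (∂Ē i p) ∂E) (∂Hs : Hom (∂Ē i p) (PI (p∂ i p))) →
      ev (p∂ i p) e₀ ∘ ∂Hs ≡ ∂w ∘ ∂s → ev (p∂ i p) e₁ ∘ ∂Hs ≡ id → W ∂w
    boundary-W ∂r ∂Hr r₀ r₁ ∂s ∂Hs s₀ s₁ =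
      homotopy-section-W {r = ∂r} ∂s (Paths.uncurry (p∂ i p) ∂Hs) (uncurry-at e₀ s₀) (uncurry-at e₁ s₁)
        (subst W (uncurry-at e₀ r₀)
          (homotopic-W (Paths.uncurry q ∂Hr) {e₁} {e₀} (subst W (sym (uncurry-at e₁ r₁)) W-id)))

theorem6p14 : ∀ {o h ℓ} (S : Setting o h ℓ) → let open Theory S in
    ∀ {∂B B : Obj} (i : Hom ∂B B) → Cof i →
    ∀ {Ē : Obj} (p : Hom Ē B) → Fib p →
    ∀ {∂E : Obj} (q : Hom ∂E ∂B) → Fib q →
    (∂w : Hom ∂E (∂Ē i p)) (∂w-over : p∂ i p ∘ ∂w ≡ q) →
    (∂r : Hom (∂Ē i p) ∂E) → q ∘ ∂r ≡ p∂ i p →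
    (∂Hr : Hom ∂E (PI q)) → πPI q ∘ ∂Hr ≡ q →
    ev q e₀ ∘ ∂Hr ≡ ∂r ∘ ∂w → ev q e₁ ∘ ∂Hr ≡ id →
    (∂s : Hom (∂Ē i p) ∂E) → q ∘ ∂s ≡ p∂ i p →
    (∂Hs : Hom (∂Ē i p) (PI (p∂ i p))) → πPI (p∂ i p) ∘ ∂Hs ≡ p∂ i p →
    ev (p∂ i p) e₀ ∘ ∂Hs ≡ ∂w ∘ ∂s → ev (p∂ i p) e₁ ∘ ∂Hs ≡ id →
    let open Glue i p q ∂w ∂w-over in
    (Σ[ r ∈ Hom Ē E ] Σ[ Hr ∈ Hom E (PI pE) ]
    ((pE ∘ r ≡ p) × (πPI pE ∘ Hr ≡ pE) ×
    (ev pE e₀ ∘ Hr ≡ r ∘ w) × (ev pE e₁ ∘ Hr ≡ id) ×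
    ((k : Hom ∂E E) → IsGlueIncl k →
    (r ∘ ι i p ≡ k ∘ ∂r) ×
    ((κ : Hom (PI q) (PI pE)) → IsPathReindex i q pE k κ →
    Hr ∘ k ≡ κ ∘ ∂Hr))))
    ×
    (Σ[ s ∈ Hom Ē E ] Σ[ Hs ∈ Hom Ē (PI p) ]
    ((pE ∘ s ≡ p) × (πPI p ∘ Hs ≡ p) ×
    (ev p e₀ ∘ Hs ≡ w ∘ s) × (ev p e₁ ∘ Hs ≡ id) ×
    ((k : Hom ∂E E) → IsGlueIncl k →
    (s ∘ ι i p ≡ k ∘ ∂s) ×
    ((κ : Hom (PI (p∂ i p)) (PI p)) → IsPathReindex i (p∂ i p) p (ι i p) κ →
    Hs ∘ ι i p ≡ κ ∘ ∂Hs))))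
theorem6p14 S i cof-i p fib-p q fib-q ∂w ∂w-over ∂r ∂r-over ∂Hr ∂Hr-over r₀ r₁ ∂s ∂s-over ∂Hs ∂Hs-over s₀ s₁ =
  retraction-extends ∂r ∂r-over ∂Hr ∂Hr-over r₀ r₁ (boundary-W ∂r ∂Hr r₀ r₁ ∂s ∂Hs s₀ s₁) ,
  section-extends ∂s ∂Hs ∂Hs-over s₀ s₁
  where open Extension.Equivalence S i cof-i p fib-p q fib-q ∂w ∂w-over
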